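{- Let $q$ be an odd prime power and let $L$ be a line of $\mathrm{PG}(5,q)$ in the $K$-orbit $o_{8,2}$. Then the hyperplane-orbit distribution of $L$ is $OD_4(L)=\left[0,\,q^2+\frac{3q+1}{2},\,\frac{q+1}{2},\,q^3-q\right]$.
   Context: A point $(y_0,\dots,y_5)$ of $\mathrm{PG}(5,q)$ is identified with the nonzero symmetric matrix $\begin{bmatrix} y_0&y_1&y_2\\ y_1&y_3&y_4\\ y_2&y_4&y_5\end{bmatrix}$ up to scalar. $K\cong\mathrm{PGL}(3,q)$ acts by $M\mapsto AMA^T$, $A\in\mathrm{GL}(3,q)$. The orbit $o_{8,2}$ (defined only for $q$ odd) is the $K$-orbit of the line $\left\{\begin{bmatrix}x&0&0\\0&y&0\\0&0&-\delta y\end{bmatrix}:(x,y)\in\mathrm{PG}(1,q)\right\}$, where $\delta$ is a non-square in $\mathbb F_q$. Hyperplanes correspond to conics of $\mathrm{PG}(2,q)$ (nonzero quadratic forms up to scalar): $\sum_{0\le i\le j\le2}a_{ij}X_iX_j$ corresponds to $a_{00}Y_0+a_{01}Y_1+a_{02}Y_2+a_{11}Y_3+a_{12}Y_4+a_{22}Y_5=0$. $\mathcal H_1,\mathcal H_{2,r},\mathcal H_{2,i},\mathcal H_3$ are the sets of hyperplanes corresponding respectively to double lines (scalar multiples of squares of linear forms), pairs of distinct real lines (products of two non-proportional linear forms over $\mathbb F_q$), pairs of conjugate imaginary lines (scalar multiples of products of two non-proportional linear forms conjugate over $\mathbb F_{q^2}$), and non-singular conics (those with $4a_{00}a_{11}a_{22}+a_{01}a_{02}a_{12}-a_{00}a_{12}^2-a_{11}a_{02}^2-a_{22}a_{01}^2\ne0$).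 $OD_4(L)=[h_1,h_{2,r},h_{2,i},h_3]$ lists the numbers of hyperplanes in $\mathcal H_1,\mathcal H_{2,r},\mathcal H_{2,i},\mathcal H_3$ containing $L$. -}

module Defs where

open import Level using (Level; _⊔_) renaming (suc to lsuc)
open import Algebra.Bundles using (AbelianGroup; CommutativeRing)
import Algebra.Construct.DirectProduct as DirectProduct
import Algebra.Definitions.RawMonoid as RawMonoid
import Algebra.Properties.Semiring.Sum as SemiringSum
import Algebra.Solver.Ring.NaturalCoefficients.Default as SemiringSolver
open import Data.Bool.Base using (if_then_else_)
open import Data.Fin.Base using (Fin)
open import Data.Fin.Patterns using (0F; 1F; 2F; 3F; 4F; 5F)
import Data.Fin.Properties as Fin
open import Data.Nat.Base as ℕ using (ℕ; suc)
open import Data.Nat.Primality using (Prime)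
open import Data.Product.Base using (Σ; ∃; ∃₂; _×_; _,_; proj₁; proj₂)
open import Data.Product.Relation.Binary.Pointwise.NonDependent using (Pointwise-≡↔≡)
open import Data.Product.Function.NonDependent.Setoid using (_×-inverse_)
open import Data.Vec.Base as Vec using (Vec)
open import Data.Vec.Functional using (Vector; []; _∷_; transpose)
import Data.Vec.Functional.Relation.Binary.Equality.Setoid as VectorEquality
open import Function.Bundles using (Inverse; _⇔_)
import Function.Construct.Composition as Composition
import Function.Construct.Symmetry as Symmetry
open import Function.Properties.Inverse using (Inverse⇒Injection)
open import Relation.Binary.Bundles using (Setoid)
import Relation.Binary.Construct.On as On
open import Relation.Binary.Definitions using (Decidable)
open import Relation.Binary.PropositionalEquality.Core as ≡ using (_≡_; _≢_)
import Relation.Binary.PropositionalEquality.Properties as ≡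
import Relation.Binary.Reasoning.Setoid as SetoidReasoning
open import Relation.Nullary.Decidable using (via-injection)
open import Relation.Nullary using (¬_; yes; no; does)

private
  variable
    a c ℓ : Level

HasSize : Setoid a ℓ → ℕ → Set (a ⊔ ℓ)
HasSize S n = Inverse S (≡.setoid (Fin n))

IsOddPrimePower : ℕ → Set
IsOddPrimePower q = ∃₂ λ p k → Prime p × p ≢ 2 × 1 ℕ.≤ k × q ≡ p ℕ.^ k

record FiniteField (c ℓ : Level) (q : ℕ) : Set (lsuc (c ⊔ ℓ)) where
  field
    commutativeRing : CommutativeRing c ℓ
  open CommutativeRing commutativeRing public
  field
    1≉0     : 1# ≉ 0#
    inverse : ∀ x → x ≉ 0# → ∃ λ y → x * y ≈ 1#
    size    : HasSize setoid q

  NonSquare : Carrier → Set (c ⊔ ℓ)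
  NonSquare x = ∀ y → y * y ≉ x

  infix 4 _≟_
  _≟_ : Decidable _≈_
  _≟_ = via-injection (Inverse⇒Injection size) Fin._≟_

-- The field with q² elements, realised for a non-square δ as F(√δ);
-- the pair (x , y) stands for x + y√δ.
module QuadraticExtension {q : ℕ} (F : FiniteField c ℓ q)
  {δ : FiniteField.Carrier F} (δ-nonSquare : FiniteField.NonSquare F δ) where

  open FiniteField F

  private
    open SemiringSolver commutativeSemiring using (solve; _:=_; _:+_; _:*_)

    K : Set c
    K = Carrier × Carrier

    infix 4 _≈ᴷ_
    _≈ᴷ_ : K → K → Set ℓ
    (x , y) ≈ᴷ (x′ , y′) = x ≈ x′ × y ≈ y′

    infixl 7 _*ᴷ_
    _*ᴷ_ : K → K → K
    (x , y) *ᴷ (x′ , y′) = x * x′ + δ * (y * y′) , x * y′ + y * x′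

    *-congᴷ : ∀ {u u′ v v′} → u ≈ᴷ u′ → v ≈ᴷ v′ → u *ᴷ v ≈ᴷ u′ *ᴷ v′
    *-congᴷ (p , p′) (r , r′) =
      +-cong (*-cong p r) (*-congˡ (*-cong p′ r′)) , +-cong (*-cong p r′) (*-cong p′ r)

    *-assocᴷ : ∀ u v w → (u *ᴷ v) *ᴷ w ≈ᴷ u *ᴷ (v *ᴷ w)
    *-assocᴷ (a , b) (c , d) (e , f) =
      solve 7 (λ a b c d e f δ →
        ((a :* c :+ δ :* (b :* d)) :* e :+ δ :* ((a :* d :+ b :* c) :* f))
        := (a :* (c :* e :+ δ :* (d :* f)) :+ δ :* (b :* (c :* f :+ d :* e)))) refl a b c d e f δ ,
      solve 7 (λ a b c d e f δ →
        ((a :* c :+ δ :* (b :* d)) :* f :+ (a :* d :+ b :* c) :* e)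
        := (a :* (c :* f :+ d :* e) :+ b :* (c :* e :+ δ :* (d :* f)))) refl a b c d e f δ

    *-commᴷ : ∀ u v → u *ᴷ v ≈ᴷ v *ᴷ u
    *-commᴷ (a , b) (c , d) =
      +-cong (*-comm a c) (*-congˡ (*-comm b d)) ,
      trans (+-comm _ _) (+-cong (*-comm b c) (*-comm a d))

    *-identityˡᴷ : ∀ u → (1# , 0#) *ᴷ u ≈ᴷ u
    *-identityˡᴷ (a , b) =
      trans (+-cong (*-identityˡ a) (trans (*-congˡ (zeroˡ b)) (zeroʳ δ))) (+-identityʳ a) ,
      trans (+-cong (*-identityˡ b) (zeroˡ a)) (+-identityʳ b)

    infixl 6 _+ᴷ_
    _+ᴷ_ : K → K → K
    (a , b) +ᴷ (c , d) = a + c , b + d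

    distribˡᴷ : ∀ u v w → u *ᴷ (v +ᴷ w) ≈ᴷ u *ᴷ v +ᴷ u *ᴷ w
    distribˡᴷ (a , b) (c , d) (e , f) =
      solve 7 (λ a b c d e f δ →
        (a :* (c :+ e) :+ δ :* (b :* (d :+ f)))
        := ((a :* c :+ δ :* (b :* d)) :+ (a :* e :+ δ :* (b :* f)))) refl a b c d e f δ ,
      solve 6 (λ a b c d e f →
        (a :* (d :+ f) :+ b :* (c :+ e))
        := ((a :* d :+ b :* c) :+ (a :* f :+ b :* e))) refl a b c d e f

    transᴷ : ∀ {u v w} → u ≈ᴷ v → v ≈ᴷ w → u ≈ᴷ w
    transᴷ (p , p′) (r , r′) = trans p r , trans p′ r′

    +-congᴷ : ∀ {u u′ v v′} → u ≈ᴷ u′ → v ≈ᴷ v′ → u +ᴷ v ≈ᴷ u′ +ᴷ v′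
    +-congᴷ (p , p′) (r , r′) = +-cong p r , +-cong p′ r′

    distribʳᴷ : ∀ u v w → (v +ᴷ w) *ᴷ u ≈ᴷ v *ᴷ u +ᴷ w *ᴷ u
    distribʳᴷ u v w =
      transᴷ (*-commᴷ (v +ᴷ w) u)
        (transᴷ (distribˡᴷ u v w) (+-congᴷ (*-commᴷ u v) (*-commᴷ u w)))

    cancel : ∀ {x y} → x ≉ 0# → x * y ≈ 0# → y ≈ 0#
    cancel {x} {y} x≉0 xy≈0 with inverse x x≉0
    ... | x⁻¹ , xx⁻¹≈1 = begin
      y               ≈⟨ *-identityˡ y ⟨
      1# * y          ≈⟨ *-congʳ xx⁻¹≈1 ⟨
      x * x⁻¹ * y     ≈⟨ solve 3 (λ x i y → (x :* i :* y) := (i :* (x :* y))) refl x x⁻¹ y ⟩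
      x⁻¹ * (x * y)   ≈⟨ *-congˡ xy≈0 ⟩
      x⁻¹ * 0#        ≈⟨ zeroʳ x⁻¹ ⟩
      0#              ∎
      where open SetoidReasoning setoid

    norm : K → Carrier
    norm (x , y) = x * x + δ * (y * - y)

    norm≉0 : ∀ u → ¬ (u ≈ᴷ (0# , 0#)) → norm u ≉ 0#
    norm≉0 (x , y) u≉0 N≈0 with y ≟ 0#
    norm≉0 (x , y) u≉0 N≈0 | yes y≈0 with x ≟ 0#
    ... | yes x≈0 = u≉0 (x≈0 , y≈0)
    ... | no  x≉0 = x≉0 (cancel x≉0 (begin
      x * x                    ≈⟨ +-identityʳ _ ⟨
      x * x + 0#               ≈⟨ +-congˡ (trans (*-congˡ (trans (*-congʳ y≈0) (zeroˡ (- y)))) (zeroʳ δ)) ⟨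
      x * x + δ * (y * - y)    ≈⟨ N≈0 ⟩
      0#                       ∎))
      where open SetoidReasoning setoid
    norm≉0 (x , y) u≉0 N≈0 | no y≉0 with inverse y y≉0
    ... | i , yi≈1 = δ-nonSquare (x * i) (begin
      x * i * (x * i)
        ≈⟨ +-identityʳ _ ⟨
      x * i * (x * i) + 0#
        ≈⟨ +-congˡ (trans (*-congˡ (-‿inverseʳ y)) (zeroʳ _)) ⟨
      x * i * (x * i) + δ * y * i * i * (y + - y)
        ≈⟨ solve 5 (λ x i δ y z →
             (x :* i :* (x :* i) :+ δ :* y :* i :* i :* (y :+ z)) :=
             ((x :* x :+ δ :* (y :* z)) :* (i :* i) :+ δ :* ((y :* i) :* (y :* i)))) refl x i δ y (- y) ⟩
      norm (x , y) * (i * i) + δ * (y * i * (y * i))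
        ≈⟨ +-cong (trans (*-congʳ N≈0) (zeroˡ _)) (*-congˡ (trans (*-cong yi≈1 yi≈1) (*-identityˡ 1#))) ⟩
      0# + δ * 1#
        ≈⟨ trans (+-identityˡ _) (*-identityʳ δ) ⟩
      δ ∎)
      where open SetoidReasoning setoid

    inverseᴷ : ∀ u → ¬ (u ≈ᴷ (0# , 0#)) → ∃ λ v → u *ᴷ v ≈ᴷ (1# , 0#)
    inverseᴷ u@(x , y) u≉0 with inverse (norm u) (norm≉0 u u≉0)
    ... | n , Nn≈1 =
      (x * n , - y * n) ,
      trans (solve 5 (λ x y z δ n →
        (x :* (x :* n) :+ δ :* (y :* (z :* n)))
        := ((x :* x :+ δ :* (y :* z)) :* n)) refl x y (- y) δ n) Nn≈1 ,
      trans (solve 4 (λ x y z n →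
        (x :* (z :* n) :+ y :* (x :* n)) := ((y :+ z) :* (x :* n))) refl x y (- y) n)
        (trans (*-congʳ (-‿inverseʳ y)) (zeroˡ _))

  F[√δ] : FiniteField c ℓ (q ℕ.* q)
  F[√δ] = record
    { commutativeRing = record
      { Carrier = K
      ; _≈_ = _≈ᴷ_
      ; _+_ = _+ᴷ_
      ; _*_ = _*ᴷ_
      ; -_ = λ (x , y) → - x , - y
      ; 0# = 0# , 0#
      ; 1# = 1# , 0#
      ; isCommutativeRing = record
        { isRing = record
          { +-isAbelianGroup = AbelianGroup.isAbelianGroup
              (DirectProduct.abelianGroup +-abelianGroup +-abelianGroup)
          ; *-cong = *-congᴷ
          ; *-assoc = *-assocᴷ
          ; *-identity = *-identityˡᴷ ,
              λ u → transᴷ (*-commᴷ u (1# , 0#)) (*-identityˡᴷ u)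
          ; distrib = distribˡᴷ , distribʳᴷ
          }
        ; *-comm = *-commᴷ
        }
      }
    ; 1≉0 = λ (1≈0 , _) → 1≉0 1≈0
    ; inverse = inverseᴷ
    ; size = Composition.inverse (size ×-inverse size)
        (Composition.inverse Pointwise-≡↔≡ (Symmetry.inverse Fin.*↔×))
    }

  embed : Carrier → FiniteField.Carrier F[√δ]
  embed x = x , 0#

  -- The nontrivial automorphism of F(√δ) over F.
  conjugate : FiniteField.Carrier F[√δ] → FiniteField.Carrier F[√δ]
  conjugate (x , y) = x , - y

module ProjectiveGeometry {q : ℕ} (F : FiniteField c ℓ q) where

  open FiniteField F
  open VectorEquality setoid using (_≋_)
  open SemiringSum semiring using (sum)
  open RawMonoid +-rawMonoid using () renaming (_×_ to _·_)

  infix 4 _∼_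
  _∼_ : ∀ {n} → Vector Carrier n → Vector Carrier n → Set (c ⊔ ℓ)
  u ∼ v = ∃ λ s → s ≉ 0# × v ≋ λ i → s * u i

  Point : ℕ → Set (c ⊔ ℓ)
  Point n = Σ (Vector Carrier (suc n)) λ v → ¬ v ≋ λ _ → 0#

  PG : ℕ → Setoid (c ⊔ ℓ) (c ⊔ ℓ)
  PG n = record
    { Carrier = Point n
    ; _≈_ = λ u v → proj₁ u ∼ proj₁ v
    ; isEquivalence = record
      { refl = 1# , 1≉0 , λ _ → sym (*-identityˡ _)
      ; sym = ∼-sym
      ; trans = ∼-trans
      }
    }
    where
    open SetoidReasoning setoid

    ∼-sym : ∀ {n} {u v : Vector Carrier n} → u ∼ v → v ∼ u
    ∼-sym {u = u} {v} (s , s≉0 , v≋su) with inverse s s≉0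
    ... | t , st≈1 =
      t ,
      (λ t≈0 → 1≉0 (trans (sym st≈1) (trans (*-congˡ t≈0) (zeroʳ s)))) ,
      λ i → begin
        u i            ≈⟨ *-identityˡ _ ⟨
        1# * u i       ≈⟨ *-congʳ (trans (*-comm t s) st≈1) ⟨
        t * s * u i    ≈⟨ *-assoc t s _ ⟩
        t * (s * u i)  ≈⟨ *-congˡ (v≋su i) ⟨
        t * v i        ∎

    ∼-trans : ∀ {n} {u v w : Vector Carrier n} → u ∼ v → v ∼ w → u ∼ w
    ∼-trans {u = u} {v} {w} (s , s≉0 , v≋su) (t , t≉0 , w≋tv) with inverse t t≉0
    ... | t⁻¹ , tt⁻¹≈1 =
      t * s ,
      (λ ts≈0 → s≉0 (begin
        s                ≈⟨ *-identityˡ s ⟨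
        1# * s           ≈⟨ *-congʳ (trans (*-comm t⁻¹ t) tt⁻¹≈1) ⟨
        t⁻¹ * t * s      ≈⟨ *-assoc t⁻¹ t s ⟩
        t⁻¹ * (t * s)    ≈⟨ *-congˡ ts≈0 ⟩
        t⁻¹ * 0#         ≈⟨ zeroʳ t⁻¹ ⟩
        0#               ∎)) ,
      λ i → trans (w≋tv i) (trans (*-congˡ (v≋su i)) (sym (*-assoc t s (u i))))

  record Line (n : ℕ) : Set (c ⊔ ℓ) where
    field
      P Q      : Point n
      distinct : ¬ proj₁ P ∼ proj₁ Q

  infix 4 _∈_
  _∈_ : ∀ {n} → Point n → Line n → Set (c ⊔ ℓ)
  (z , _) ∈ L = ∃₂ λ s t → z ≋ λ i → s * proj₁ P i + t * proj₁ Q i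
    where open Line L

  Matrix : Set c
  Matrix = Vector (Vector Carrier 3) 3

  infix 4 _≋ₘ_ _∼ₘ_
  _≋ₘ_ : Matrix → Matrix → Set ℓ
  M ≋ₘ N = ∀ i → M i ≋ N i

  _∼ₘ_ : Matrix → Matrix → Set (c ⊔ ℓ)
  M ∼ₘ N = ∃ λ s → s ≉ 0# × N ≋ₘ λ i j → s * M i j

  infixl 7 _*ₘ_
  _*ₘ_ : Matrix → Matrix → Matrix
  (M *ₘ N) i j = sum λ k → M i k * N k j

  1ₘ : Matrix
  1ₘ i j = if does (i Fin.≟ j) then 1# else 0#

  GL₃ : Set (c ⊔ ℓ)
  GL₃ = Σ Matrix λ A → ∃ λ B → A *ₘ B ≋ₘ 1ₘ × B *ₘ A ≋ₘ 1ₘ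

  toMatrix : Point 5 → Matrix
  toMatrix (y , _) =
    (y 0F ∷ y 1F ∷ y 2F ∷ []) ∷
    (y 1F ∷ y 3F ∷ y 4F ∷ []) ∷
    (y 2F ∷ y 4F ∷ y 5F ∷ []) ∷ []

  -- z is the image of y under the element of K induced by A.
  Maps : GL₃ → Point 5 → Point 5 → Set (c ⊔ ℓ)
  Maps (A , _) y z = A *ₘ toMatrix y *ₘ transpose A ∼ₘ toMatrix z

  InRepresentative₈₂ : Carrier → Point 5 → Set (c ⊔ ℓ)
  InRepresentative₈₂ δ z = ∃ λ ((xy , _) : Point 1) →
    let x = xy 0F
        y = xy 1F
    in toMatrix z ∼ₘ
      ((x  ∷ 0# ∷ 0#        ∷ []) ∷
       (0# ∷ y  ∷ 0#        ∷ []) ∷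
       (0# ∷ 0# ∷ - (δ * y) ∷ []) ∷ [])

  -- Lines are compared as sets of points.
  InOrbit₈₂ : Carrier → Line 5 → Set (c ⊔ ℓ)
  InOrbit₈₂ δ L = ∃ λ A → ∀ z →
    z ∈ L ⇔ (∃ λ y → InRepresentative₈₂ δ y × Maps A y z)

  LinearForm : Set (c ⊔ ℓ)
  LinearForm = Point 2

  -- A nonzero quadratic form, and equally the hyperplane of PG(5,q) it
  -- corresponds to, is given by (a₀₀, a₀₁, a₀₂, a₁₁, a₁₂, a₂₂).
  Hyperplane : Set (c ⊔ ℓ)
  Hyperplane = Point 5

  formProduct : LinearForm → LinearForm → Vector Carrier 6
  formProduct (l , _) (m , _) =
    l 0F * m 0F ∷
    l 0F * m 1F + l 1F * m 0F ∷
    l 0F * m 2F + l 2F * m 0F ∷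
    l 1F * m 1F ∷
    l 1F * m 2F + l 2F * m 1F ∷
    l 2F * m 2F ∷ []

  discriminant : Vector Carrier 6 → Carrier
  discriminant a =
    4 · (a₀₀ * a₁₁ * a₂₂) + a₀₁ * a₀₂ * a₁₂
      - a₀₀ * (a₁₂ * a₁₂) - a₁₁ * (a₀₂ * a₀₂) - a₂₂ * (a₀₁ * a₀₁)
    where
    a₀₀ a₀₁ a₀₂ a₁₁ a₁₂ a₂₂ : Carrier
    a₀₀ = a 0F
    a₀₁ = a 1F
    a₀₂ = a 2F
    a₁₁ = a 3F
    a₁₂ = a 4F
    a₂₂ = a 5F

  ℋ₁ : Hyperplane → Set (c ⊔ ℓ)
  ℋ₁ (a , _) = ∃₂ λ s l → a ≋ λ i → s * formProduct l l i

  ℋ₂ᵣ : Hyperplane → Set (c ⊔ ℓ)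
  ℋ₂ᵣ (a , _) = ∃₂ λ l m → ¬ proj₁ l ∼ proj₁ m × a ≋ formProduct l m

  ℋ₃ : Hyperplane → Set ℓ
  ℋ₃ (a , _) = discriminant a ≉ 0#

  infix 4 _⊆_
  _⊆_ : Line 5 → Hyperplane → Set (c ⊔ ℓ)
  L ⊆ (a , _) = ∀ z → z ∈ L → sum (λ i → a i * proj₁ z i) ≈ 0#

  -- The proofs of membership in H and of containing L play no part in the equality.
  Through : ∀ {h} → Line 5 → (Hyperplane → Set h) → Setoid (c ⊔ ℓ ⊔ h) (c ⊔ ℓ)
  Through L H = On.setoid (PG 5) (proj₁ {A = Hyperplane} {B = λ a → H a × L ⊆ a})

module HyperplaneOrbits {q : ℕ} (F : FiniteField c ℓ q)
  {δ : FiniteField.Carrier F} (δ-nonSquare : FiniteField.NonSquare F δ) where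

  open ProjectiveGeometry F
  open QuadraticExtension F δ-nonSquare
  private
    module K  = FiniteField F[√δ]
    module PK = ProjectiveGeometry F[√δ]
  open VectorEquality K.setoid using () renaming (_≋_ to _≋ᴷ_)

  -- The scalar may be taken in F, since a product of conjugate forms is
  -- itself defined over F.
  ℋ₂ᵢ : Hyperplane → Set (c ⊔ ℓ)
  ℋ₂ᵢ (a , _) = ∃₂ λ s l → ∃ λ (l̄ : PK.LinearForm) →
    (∀ i → proj₁ l̄ i K.≈ conjugate (proj₁ l i)) ×
    ¬ (proj₁ l PK.∼ proj₁ l̄) ×
    (λ i → embed (a i)) ≋ᴷ (λ i → embed s K.* PK.formProduct l l̄ i)

  HasOD₄ : Line 5 → Vec ℕ 4 → Set (c ⊔ ℓ)
  HasOD₄ L (h₁ Vec.∷ h₂ᵣ Vec.∷ h₂ᵢ Vec.∷ h₃ Vec.∷ Vec.[]) =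
    HasSize (Through L ℋ₁) h₁ ×
    HasSize (Through L ℋ₂ᵣ) h₂ᵣ ×
    HasSize (Through L ℋ₂ᵢ) h₂ᵢ ×
    HasSize (Through L ℋ₃) h₃

{-# OPTIONS --safe #-}

-- A substitution A carrying the representative of o₈,₂ to L acts on hyperplanes, preserves
-- each of the four classes, and turns the hyperplanes through L into the forms with
-- a₀₀ = 0 and a₁₁ = δa₂₂, that is X(bY + dZ) + c(δY² + Z²) + eYZ.  If (b, d) ≠ 0, such a
-- form is singular exactly when bY + dZ divides it, and it is then a pair of real lines.
-- If b = d = 0, it is YZ or, up to a scalar, δY² + eYZ + Z².  The latter splits exactly
-- when e = u + δ/u for some u; as u ↦ δ/u has no fixed points on the q − 1 nonzero
-- elements, (q − 1)/2 values of e do so, and the other (q + 1)/2 give conjugate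
-- imaginary lines.
module Submission where

open import Defs
open import Level using (Level; _⊔_)
open import Algebra.Bundles using (CommutativeRing; RawRing)
import Algebra.Properties.AbelianGroup
import Algebra.Properties.Ring
import Algebra.Properties.Semiring.Mult.TCOptimised as Mult
import Algebra.Solver.Ring
open import Algebra.Solver.Ring.AlmostCommutativeRing
import Algebra.Solver.Ring.NaturalCoefficients.Default as SemiringSolver
open import Data.Bool.Base using (if_then_else_)
open import Data.Empty using (⊥-elim)
open import Data.Fin.Base as Fin using (Fin; zero; suc; punchOut; _↑ˡ_; _↑ʳ_)
open import Data.Fin.Patterns using (0F; 1F; 2F; 3F; 4F; 5F)
open import Data.Fin.Permutation using (↔⇒≡)
import Data.Fin.Properties as Fin
open import Data.Maybe.Base using (Maybe; just; nothing)
open import Data.Nat.Base as ℕ using (ℕ; zero; suc)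
open import Data.Nat.DivMod using (m*n/n≡m)
import Data.Nat.Properties as ℕ
import Data.Nat.Solver as ℕSolver
open import Data.Product.Base using (∃; ∃₂; _×_; _,_; proj₁; proj₂)
open import Data.Product.Function.NonDependent.Setoid using (_×-inverse_)
open import Data.Product.Relation.Binary.Pointwise.NonDependent using (_×ₛ_)
  renaming (Pointwise-≡↔≡ to ×-Pointwise-≡↔≡)
open import Data.Sum.Base as Sum using (_⊎_; inj₁; inj₂; [_,_])
open import Data.Sum.Function.Setoid using (_⊎-inverse_)
open import Data.Sum.Relation.Binary.Pointwise using (_⊎ₛ_; inj₁; inj₂)
  renaming (Pointwise-≡↔≡ to ⊎-Pointwise-≡↔≡)
open import Data.Vec.Base as Vec using (Vec)
import Data.Vec.Functional.Relation.Binary.Equality.Setoid as VectorEquality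
open import Function.Base using (_∘_)
open import Function.Bundles using (Equivalence; Inverse)
import Function.Construct.Composition as Composition
import Function.Construct.Identity as Identity
import Function.Construct.Symmetry as Symmetry
open import Relation.Binary.Bundles using (Setoid)
import Relation.Binary.Construct.On as On
open import Relation.Binary.Definitions using (_Respects_)
open import Relation.Binary.PropositionalEquality.Core as ≡ using (_≡_)
import Relation.Binary.PropositionalEquality.Properties as ≡
import Relation.Binary.Reasoning.Setoid as SetoidReasoning
open import Relation.Nullary using (¬_; ¬?; yes; no; Dec; does)
open import Relation.Nullary.Decidable using (map′)
open import Relation.Unary using (Pred; Decidable)

-- The apolar forms fill a PG(3,q), which the first nonzero one of b, d, c, e cuts into cells of q³,
-- q², q and 1 elements, with one normal form per hyperplane. Coordinates are chosen so that each
-- class restricts a single coordinate of a cell; all counts are then products of q with sizes of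
-- subsets of F. The cell b = 1 needs care: its singular forms satisfy de = c(δd² + 1), and neither
-- c nor e is a parameter for all d, since d = 0 makes c vanish and δd² + 1 may be 0. As d and δd² +
-- 1 are never both 0, c = sd, e = s(δd² + 1) works throughout; a coordinate t completes this to a
-- change of coordinates of determinant -1 in which the discriminant is -t. Conjugate imaginary
-- pairs are the one class defined through F(√δ). Rewriting them over F as multiples of x² - δy²
-- with x, y independent keeps the group action, and the fact that x = y = 0 at every zero of such a
-- form, inside F. That every non-split e gives such a pair rests on F being exhausted by squares
-- and δ-multiples of squares: e² - 4δ = δw² with w nonzero.

private
  variable
    a b c p r ℓ ℓ₁ ℓ₂ : Level

-- A ring solver with integer coefficients

module IntegerSolver (R : CommutativeRing c ℓ) where

  open CommutativeRing R
  private
    open Mult semiring using ()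
      renaming (_×_ to _·_; ×-homo-+ to ·-homo-+; ×1-homo-* to ·1-homo-*; 1+× to 1+·)
    open Algebra.Properties.Ring ring using (-‿distribˡ-*; -‿distribʳ-*; -0#≈0#)
    open Algebra.Properties.AbelianGroup +-abelianGroup using (⁻¹-∙-comm; ⁻¹-involutive)
    open SetoidReasoning setoid
    open SemiringSolver commutativeSemiring using ()
      renaming (solve to solveₛ; _:=_ to _≔_; _:+_ to _⊕_; _:*_ to _⊗_)

    ι : ℕ → Carrier
    ι n = n · 1#

    -- The pair (m , n) stands for m − n and is kept reduced, so that equal coefficients are
    -- equal pairs; ⟦_⟧ₙ is chosen to send (0 , 0) and (1 , 0) definitionally to 0# and 1#.
    ⟦_⟧ℤ : ℕ × ℕ → Carrier
    ⟦ m , n ⟧ℤ = ι m - ι n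

    ⟦_⟧ₙ : ℕ × ℕ → Carrier
    ⟦ m , zero ⟧ₙ  = ι m
    ⟦ m , suc n ⟧ₙ = ι m - ι (suc n)

    x-0≈x : ∀ x → x - 0# ≈ x
    x-0≈x x = trans (+-congˡ -0#≈0#) (+-identityʳ x)

    ⟦⟧ₙ≈⟦⟧ℤ : ∀ mn → ⟦ mn ⟧ₙ ≈ ⟦ mn ⟧ℤ
    ⟦⟧ₙ≈⟦⟧ℤ (m , zero)  = sym (x-0≈x (ι m))
    ⟦⟧ₙ≈⟦⟧ℤ (m , suc n) = refl

    interchange : ∀ a b x y → a + b + (x + y) ≈ (a + x) + (b + y)
    interchange = solveₛ 4 (λ a b x y → a ⊕ b ⊕ (x ⊕ y) ≔ (a ⊕ x) ⊕ (b ⊕ y)) refl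

    reduce : ℕ × ℕ → ℕ × ℕ
    reduce (suc m , suc n) = reduce (m , n)
    reduce mn = mn

    reduce-correct : ∀ mn → ⟦ reduce mn ⟧ℤ ≈ ⟦ mn ⟧ℤ
    reduce-correct (zero  , n)     = refl
    reduce-correct (suc m , zero)  = refl
    reduce-correct (suc m , suc n) = begin
      ⟦ reduce (m , n) ⟧ℤ             ≈⟨ reduce-correct (m , n) ⟩
      ι m - ι n                       ≈⟨ +-identityˡ _ ⟨
      0# + (ι m - ι n)                ≈⟨ +-congʳ (-‿inverseʳ 1#) ⟨
      1# - 1# + (ι m - ι n)           ≈⟨ interchange 1# (- 1#) (ι m) (- ι n) ⟩
      1# + ι m + (- 1# - ι n)         ≈⟨ +-congˡ (⁻¹-∙-comm _ _) ⟩
      1# + ι m - (1# + ι n)           ≈⟨ +-cong (1+· m 1#) (-‿cong (1+· n 1#)) ⟨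
      ι (suc m) - ι (suc n)           ∎

    integers : RawRing _ _
    integers = record
      { Carrier = ℕ × ℕ
      ; _≈_ = _≡_
      ; _+_ = λ (m , n) (m′ , n′) → reduce (m ℕ.+ m′ , n ℕ.+ n′)
      ; _*_ = λ (m , n) (m′ , n′) → reduce (m ℕ.* m′ ℕ.+ n ℕ.* n′ , m ℕ.* n′ ℕ.+ n ℕ.* m′)
      ; -_ = λ (m , n) → n , m
      ; 0# = 0 , 0
      ; 1# = 1 , 0
      }

    morphism : integers -Raw-AlmostCommutative⟶ fromCommutativeRing R
    morphism = record
      { ⟦_⟧ = ⟦_⟧ₙ
      ; +-homo = λ (m , n) (m′ , n′) → begin
          ⟦ reduce (m ℕ.+ m′ , n ℕ.+ n′) ⟧ₙ    ≈⟨ ⟦reduce⟧ₙ (m ℕ.+ m′ , n ℕ.+ n′) ⟩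
          ι (m ℕ.+ m′) - ι (n ℕ.+ n′)
            ≈⟨ +-cong (·-homo-+ 1# m m′) (trans (-‿cong (·-homo-+ 1# n n′)) (sym (⁻¹-∙-comm _ _))) ⟩
          ι m + ι m′ + (- ι n - ι n′)
            ≈⟨ interchange _ _ _ _ ⟩
          ι m - ι n + (ι m′ - ι n′)            ≈⟨ +-cong (⟦⟧ₙ≈⟦⟧ℤ (m , n)) (⟦⟧ₙ≈⟦⟧ℤ (m′ , n′)) ⟨
          ⟦ m , n ⟧ₙ + ⟦ m′ , n′ ⟧ₙ            ∎
      ; *-homo = λ (m , n) (m′ , n′) → begin
          ⟦ reduce (m ℕ.* m′ ℕ.+ n ℕ.* n′ , m ℕ.* n′ ℕ.+ n ℕ.* m′) ⟧ₙ
            ≈⟨ ⟦reduce⟧ₙ (m ℕ.* m′ ℕ.+ n ℕ.* n′ , m ℕ.* n′ ℕ.+ n ℕ.* m′) ⟩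
          ι (m ℕ.* m′ ℕ.+ n ℕ.* n′) - ι (m ℕ.* n′ ℕ.+ n ℕ.* m′)
            ≈⟨ +-cong (homo m m′ n n′) (trans (-‿cong (homo m n′ n m′)) (sym (⁻¹-∙-comm _ _))) ⟩
          (ι m * ι m′ + ι n * ι n′) + (- (ι m * ι n′) - ι n * ι m′)
            ≈⟨ +-cong (+-congˡ (trans (sym (⁻¹-involutive _))
                 (trans (-‿cong (-‿distribʳ-* _ _)) (-‿distribˡ-* _ _))))
                 (+-cong (-‿distribʳ-* _ _) (-‿distribˡ-* _ _)) ⟩
          (ι m * ι m′ + - ι n * - ι n′) + (ι m * - ι n′ + - ι n * ι m′)
            ≈⟨ solveₛ 4 (λ a b x y →
                 (a ⊗ x ⊕ b ⊗ y) ⊕ (a ⊗ y ⊕ b ⊗ x) ≔ (a ⊕ b) ⊗ (x ⊕ y)) refl _ _ _ _ ⟩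
          (ι m - ι n) * (ι m′ - ι n′)          ≈⟨ *-cong (⟦⟧ₙ≈⟦⟧ℤ (m , n)) (⟦⟧ₙ≈⟦⟧ℤ (m′ , n′)) ⟨
          ⟦ m , n ⟧ₙ * ⟦ m′ , n′ ⟧ₙ            ∎
      ; -‿homo = λ (m , n) → begin
          ⟦ n , m ⟧ₙ           ≈⟨ ⟦⟧ₙ≈⟦⟧ℤ (n , m) ⟩
          ι n - ι m            ≈⟨ +-comm _ _ ⟩
          - ι m + ι n          ≈⟨ +-congˡ (⁻¹-involutive _) ⟨
          - ι m - - ι n        ≈⟨ ⁻¹-∙-comm _ _ ⟩
          - (ι m - ι n)        ≈⟨ -‿cong (⟦⟧ₙ≈⟦⟧ℤ (m , n)) ⟨
          - ⟦ m , n ⟧ₙ         ∎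
      ; 0-homo = refl
      ; 1-homo = refl
      }
      where
      ⟦reduce⟧ₙ : ∀ mn → ⟦ reduce mn ⟧ₙ ≈ ⟦ mn ⟧ℤ
      ⟦reduce⟧ₙ mn = trans (⟦⟧ₙ≈⟦⟧ℤ (reduce mn)) (reduce-correct mn)

      homo : ∀ m m′ n n′ → ι (m ℕ.* m′ ℕ.+ n ℕ.* n′) ≈ ι m * ι m′ + ι n * ι n′
      homo m m′ n n′ = trans (·-homo-+ 1# (m ℕ.* m′) _) (+-cong (·1-homo-* m m′) (·1-homo-* n n′))

    -- Comparing reduced pairs decides equality of integers, not equality in the ring; this suffices
    -- for identities valid in every commutative ring.
    _coeff≟_ : ∀ a b → Maybe (⟦ a ⟧ₙ ≈ ⟦ b ⟧ₙ)
    (m , n) coeff≟ (m′ , n′) with m ℕ.≟ m′ | n ℕ.≟ n′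
    ... | yes ≡.refl | yes ≡.refl = just refl
    ... | _          | _          = nothing

  open Algebra.Solver.Ring integers (fromCommutativeRing R) morphism _coeff≟_ public

  :0 :1 : ∀ {n} → Polynomial n
  :0 = con (0 , 0)
  :1 = con (1 , 0)

-- Sizes of finite setoids

infixl 3 _↾_
-- Proofs of P are ignored by the equality, as in `Through`, so an element with several proofs is
-- counted once.
_↾_ : (S : Setoid a ℓ) → Pred (Setoid.Carrier S) p → Setoid (a ⊔ p) ℓ
S ↾ P = On.setoid S (proj₁ {B = P})

bijection⇒inverse : (S : Setoid a ℓ₁) (T : Setoid b ℓ₂) →
  let open Setoid S using () renaming (Carrier to A; _≈_ to _≈₁_)
      open Setoid T using () renaming (Carrier to B; _≈_ to _≈₂_)
  in (f : A → B) → (∀ {x y} → x ≈₁ y → f x ≈₂ f y) → (∀ {x y} → f x ≈₂ f y → x ≈₁ y) →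
     (∀ y → ∃ λ x → f x ≈₂ y) → Inverse S T
bijection⇒inverse S T f cong injective surjective = record
  { to = f
  ; from = proj₁ ∘ surjective
  ; to-cong = cong
  ; from-cong = λ {x} {y} x≈y → injective
      (T.trans (proj₂ (surjective x)) (T.trans x≈y (T.sym (proj₂ (surjective y)))))
  ; inverse =
      (λ {x} y≈ → T.trans (cong y≈) (proj₂ (surjective x))) ,
      (λ {x} {y} y≈ → injective (T.trans (proj₂ (surjective y)) y≈))
  }
  where module T = Setoid T

module _ {S : Setoid a ℓ₁} {T : Setoid b ℓ₂} where

  size-resp : ∀ {n} → Inverse S T → HasSize S n → HasSize T n
  size-resp S↔T = Composition.inverse (Symmetry.inverse S↔T)

  size-⊎ : ∀ {m n} → HasSize S m → HasSize T n → HasSize (S ⊎ₛ T) (m ℕ.+ n)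
  size-⊎ S↔ T↔ = Composition.inverse (S↔ ⊎-inverse T↔)
    (Composition.inverse (⊎-Pointwise-≡↔≡ _ _) (Symmetry.inverse Fin.+↔⊎))

  size-× : ∀ {m n} → HasSize S m → HasSize T n → HasSize (S ×ₛ T) (m ℕ.* n)
  size-× S↔ T↔ = Composition.inverse (S↔ ×-inverse T↔)
    (Composition.inverse ×-Pointwise-≡↔≡ (Symmetry.inverse Fin.*↔×))

size-unique : ∀ {m n} (S : Setoid a ℓ) → HasSize S m → HasSize S n → m ≡ n
size-unique S S↔m S↔n = ↔⇒≡ (Composition.inverse (Symmetry.inverse S↔m) S↔n)

module _ {S : Setoid a ℓ₁} {T : Setoid b ℓ₂} where

  size-↾-⊎ : ∀ {m n} {P : Pred (Setoid.Carrier S ⊎ Setoid.Carrier T) p} →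
    HasSize (S ↾ P ∘ inj₁) m → HasSize (T ↾ P ∘ inj₂) n → HasSize (S ⊎ₛ T ↾ P) (m ℕ.+ n)
  size-↾-⊎ S↔ T↔ = size-resp
    (bijection⇒inverse _ _
      [ (λ (x , px) → inj₁ x , px) , (λ (y , py) → inj₂ y , py) ]
      (λ { (inj₁ x≈y) → inj₁ x≈y ; (inj₂ x≈y) → inj₂ x≈y })
      (λ { {inj₁ _} {inj₁ _} (inj₁ x≈y) → inj₁ x≈y ; {inj₂ _} {inj₂ _} (inj₂ x≈y) → inj₂ x≈y })
      (λ { (inj₁ x , px) → inj₁ (x , px) , inj₁ (Setoid.refl S)
         ; (inj₂ y , py) → inj₂ (y , py) , inj₂ (Setoid.refl T) }))
    (size-⊎ S↔ T↔)

  size-↾-× : ∀ {m n} {P : Pred (Setoid.Carrier T) p} →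
    HasSize S m → HasSize (T ↾ P) n → HasSize (S ×ₛ T ↾ P ∘ proj₂) (m ℕ.* n)
  size-↾-× S↔ T↔ = size-resp
    (bijection⇒inverse _ _
      (λ (x , (y , py)) → (x , y) , py) (λ x≈y → x≈y) (λ x≈y → x≈y)
      (λ ((x , y) , py) → (x , (y , py)) , (Setoid.refl S , Setoid.refl T)))
    (size-× S↔ T↔)

module _ {S : Setoid a ℓ} where

  open Setoid S using (_≈_; refl)

  size-↾-⇔ : ∀ {n} {P : Pred (Setoid.Carrier S) p} {Q : Pred (Setoid.Carrier S) r} →
    (∀ x → P x → Q x) → (∀ x → Q x → P x) → HasSize (S ↾ P) n → HasSize (S ↾ Q) n
  size-↾-⇔ P⇒Q Q⇒P = size-resp
    (bijection⇒inverse _ _ (λ (x , px) → x , P⇒Q x px) (λ x≈y → x≈y) (λ x≈y → x≈y)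
      (λ (x , qx) → (x , Q⇒P x qx) , refl))

  size-↾-∅ : {P : Pred (Setoid.Carrier S) p} → (∀ x → ¬ P x) → HasSize (S ↾ P) 0
  size-↾-∅ ¬P = record
    { to = λ (x , px) → ⊥-elim (¬P x px)
    ; from = λ ()
    ; to-cong = λ { {x , px} → ⊥-elim (¬P x px) }
    ; from-cong = λ { {()} }
    ; inverse = (λ { {()} }) , λ { {x , px} → ⊥-elim (¬P x px) }
    }

  size-↾-all : ∀ {n} {P : Pred (Setoid.Carrier S) p} → (∀ x → P x) → HasSize S n → HasSize (S ↾ P) n
  size-↾-all P-all = size-resp
    (bijection⇒inverse _ _ (λ x → x , P-all x) (λ x≈y → x≈y) (λ x≈y → x≈y)
      (λ (x , _) → x , refl))

  size-↾-singleton : {P : Pred (Setoid.Carrier S) p} → ∀ x → P x → (∀ y → P y → x ≈ y) →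
    HasSize (S ↾ P) 1
  size-↾-singleton x px unique = record
    { to = λ _ → zero
    ; from = λ _ → x , px
    ; to-cong = λ _ → ≡.refl
    ; from-cong = λ _ → refl
    ; inverse = (λ { {zero} _ → ≡.refl }) , λ { {y , py} _ → unique y py }
    }

count : ∀ {n} {P : Pred (Fin n) p} → Decidable P → ∃ (HasSize (≡.setoid (Fin n) ↾ P))
count {n = zero}          P? = 0 , size-↾-∅ λ ()
count {n = suc n} {P} P? with count (P? ∘ suc) | P? zero
... | k , S↔k | yes p₀ = suc k , size-resp
  (bijection⇒inverse _ _
    [ (λ _ → zero , p₀) , (λ (i , pᵢ) → suc i , pᵢ) ]
    (λ { (inj₁ _) → ≡.refl ; (inj₂ ≡.refl) → ≡.refl })
    (λ { {inj₁ zero} {inj₁ zero} _ → inj₁ ≡.refl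
       ; {inj₁ _} {inj₂ _} ()
       ; {inj₂ _} {inj₁ _} ()
       ; {inj₂ _} {inj₂ _} eq → inj₂ (Fin.suc-injective eq) })
    (λ { (zero , p) → inj₁ zero , ≡.refl ; (suc i , pᵢ) → inj₂ (i , pᵢ) , ≡.refl }))
  (size-⊎ (Identity.inverse (≡.setoid (Fin 1))) S↔k)
... | k , S↔k | no ¬p₀ = k , size-resp
  (bijection⇒inverse _ _
    (λ (i , pᵢ) → suc i , pᵢ) (≡.cong suc) Fin.suc-injective
    (λ { (zero , p) → ⊥-elim (¬p₀ p) ; (suc i , pᵢ) → (i , pᵢ) , ≡.refl }))
  S↔k

-- Complements, the pigeonhole principle and involutions on a finite setoid

module Finite {n : ℕ} (S : Setoid a ℓ) (S↔n : HasSize S n) where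

  open Setoid S
  open Inverse S↔n using (to; from; to-cong; from-cong; strictlyInverseˡ; strictlyInverseʳ)

  to-injective : ∀ {x y} → to x ≡ to y → x ≈ y
  to-injective {x} {y} eq =
    trans (sym (strictlyInverseʳ x)) (trans (from-cong eq) (strictlyInverseʳ y))

  count-↾ : {P : Pred Carrier p} → P Respects _≈_ → Decidable P → ∃ (HasSize (S ↾ P))
  count-↾ resp P? with count (P? ∘ from)
  ... | k , S↔k = k , size-resp
    (bijection⇒inverse _ _
      (λ (i , pᵢ) → from i , pᵢ) from-cong
      (λ {(i , _)} {(j , _)} eq →
        ≡.trans (≡.sym (strictlyInverseˡ i)) (≡.trans (to-cong eq) (strictlyInverseˡ j)))
      (λ (x , px) → (to x , resp (sym (strictlyInverseʳ x)) px) , strictlyInverseʳ x))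
    S↔k

  -- `count-↾` supplies some size m of the complement; uniqueness of the size of S then forces k + m
  -- = n.
  size-complement : {P : Pred Carrier p} → P Respects _≈_ → Decidable P → ∀ {k} →
    HasSize (S ↾ P) k → ∃ λ m → HasSize (S ↾ ¬_ ∘ P) m × k ℕ.+ m ≡ n
  size-complement {P = P} resp P? {k} P↔k
    with count-↾ (λ x≈y ¬px py → ¬px (resp (sym x≈y) py)) (¬? ∘ P?)
  ... | m , ¬P↔m = m , ¬P↔m , size-unique S (size-resp
    (bijection⇒inverse ((S ↾ P) ⊎ₛ (S ↾ ¬_ ∘ P)) S
      [ proj₁ , proj₁ ]
      (λ { (inj₁ eq) → eq ; (inj₂ eq) → eq })
      (λ { {inj₁ _} {inj₁ _} eq → inj₁ eq
         ; {inj₁ (_ , px)} {inj₂ (_ , ¬py)} eq → ⊥-elim (¬py (resp eq px))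
         ; {inj₂ (_ , ¬px)} {inj₁ (_ , py)} eq → ⊥-elim (¬px (resp (sym eq) py))
         ; {inj₂ _} {inj₂ _} eq → inj₂ eq })
      total)
    (size-⊎ P↔k ¬P↔m)) S↔n
    where
    total : ∀ x → ∃ λ (y : (∃ P) ⊎ (∃ (¬_ ∘ P))) → [ proj₁ , proj₁ ] y ≈ x
    total x with P? x
    ... | yes px = inj₁ (x , px) , refl
    ... | no ¬px = inj₂ (x , ¬px) , refl

  -- If y were missed, the endomap transported to Fin n would be an injection missing an index;
  -- deleting that index contradicts the pigeonhole principle.
  injective⇒surjective : (f : Carrier → Carrier) → (∀ {x y} → x ≈ y → f x ≈ f y) →
    (∀ {x y} → f x ≈ f y → x ≈ y) → ∀ y → ∃ λ x → f x ≈ y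
  injective⇒surjective f cong injective y
    with Fin.any? (λ i → to (f (from i)) Fin.≟ to y)
  ... | yes (i , eq) = from i , to-injective eq
  ... | no missed = ⊥-elim (ℕ.1+n≰n (bound (to y) (to ∘ f ∘ from)
      (λ {i} {j} eq → ≡.trans (≡.sym (strictlyInverseˡ i))
        (≡.trans (to-cong (injective (to-injective eq))) (strictlyInverseˡ j)))
      (λ i eq → missed (i , ≡.sym eq))))
    where
    bound : ∀ {m} (j : Fin m) (g : Fin m → Fin m) → (∀ {i i′} → g i ≡ g i′ → i ≡ i′) →
      (∀ i → ¬ j ≡ g i) → suc m ℕ.≤ m
    bound {suc m} j g g-injective j∉g =
      ℕ.s≤s (Fin.injective⇒≤ {f = λ i → punchOut (j∉g i)}
        (λ {i} {i′} eq → g-injective (Fin.punchOut-injective (j∉g i) (j∉g i′) eq)))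

  -- A total order on S, used to pick one element from each orbit of an involution.
  infix 4 _≺_ _≺?_
  _≺_ : Carrier → Carrier → Set
  x ≺ y = to x Fin.< to y

  _≺?_ : ∀ x y → Dec (x ≺ y)
  x ≺? y = to x Fin.<? to y

  ≺-resp-≈ : ∀ {x x′ y y′} → x ≈ x′ → y ≈ y′ → x ≺ y → x′ ≺ y′
  ≺-resp-≈ x≈x′ y≈y′ = ≡.subst₂ Fin._<_ (to-cong x≈x′) (to-cong y≈y′)

  ≺-asym : ∀ {x y} → x ≺ y → ¬ y ≺ x
  ≺-asym = Fin.<-asym

  ⊀⇒≻ : ∀ {x y} → ¬ x ≈ y → ¬ x ≺ y → y ≺ x
  ⊀⇒≻ {x} {y} x≉y x⊀y = ℕ.≤∧≢⇒< (ℕ.≮⇒≥ x⊀y) (x≉y ∘ to-injective ∘ ≡.sym ∘ Fin.toℕ-injective)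

  -- f exchanges the elements with x ≺ f x and those with f x ≺ x, and without fixed points these
  -- two halves fill S.
  size-involution : (f : Carrier → Carrier) → (∀ {x y} → x ≈ y → f x ≈ f y) →
    (∀ x → f (f x) ≈ x) → (∀ x → ¬ x ≈ f x) →
    ∃ λ k → HasSize (S ↾ λ x → x ≺ f x) k × k ℕ.+ k ≡ n
  size-involution f cong involutive fixed-point-free
    with count-↾ (λ x≈y → ≺-resp-≈ x≈y (cong x≈y)) (λ x → x ≺? f x)
  ... | k , P↔k
    with size-complement (λ x≈y → ≺-resp-≈ x≈y (cong x≈y)) (λ x → x ≺? f x) P↔k
  ... | m , ¬P↔m , k+m≡n = k , P↔k , ≡.trans (≡.cong (k ℕ.+_) k≡m) k+m≡n
    where
    k≡m : k ≡ m
    k≡m = size-unique (S ↾ λ x → ¬ x ≺ f x) (size-resp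
      (bijection⇒inverse (S ↾ λ x → x ≺ f x) (S ↾ λ x → ¬ x ≺ f x)
        (λ (x , x≺fx) → f x , λ fx≺ffx → ≺-asym x≺fx (≺-resp-≈ refl (involutive x) fx≺ffx))
        cong
        (λ {(x , _)} {(y , _)} eq → trans (sym (involutive x)) (trans (cong eq) (involutive y)))
        (λ (y , y⊀fy) →
          (f y , ≺-resp-≈ refl (sym (involutive y)) (⊀⇒≻ (fixed-point-free y) y⊀fy)) ,
          involutive y))
      P↔k) ¬P↔m

-- Finite fields of odd order

module FieldProperties {q : ℕ} (F : FiniteField c ℓ q) where

  open FiniteField F
  open IntegerSolver commutativeRing public
    using (solve; _:=_; _:+_; _:*_; _:-_; :-_; var; prove; :0; :1; Polynomial)
  open Algebra.Properties.AbelianGroup +-abelianGroup public using ()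
    renaming (∙-cancelʳ to +-cancelʳ)
  open Finite setoid size public

  -- Here l ≈ r is a linear combination of hypotheses and the second argument a ring identity.
  by-combination : ∀ {x y l r} → l ≈ r → x + r ≈ y + l → x ≈ y
  by-combination {x} {y} {l} {r} l≈r x+r≈y+l =
    +-cancelʳ r x y (trans x+r≈y+l (+-congˡ l≈r))

  opaque
    nonzero-cancel : ∀ {x y} → x ≉ 0# → x * y ≈ 0# → y ≈ 0#
    nonzero-cancel {x} {y} x≉0 xy≈0 with inverse x x≉0
    ... | i , xi≈1 = by-combination (+-cong (*-congˡ {i} xy≈0) (*-congˡ {y} (sym xi≈1)))
      (solve 3 (λ x y i → y :+ (i :* :0 :+ y :* (x :* i)) := :0 :+ (i :* (x :* y) :+ y :* :1))
        refl x y i)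

  zero-product : ∀ {x y} → x * y ≈ 0# → x ≈ 0# ⊎ y ≈ 0#
  zero-product {x} {y} xy≈0 with x ≟ 0#
  ... | yes x≈0 = inj₁ x≈0
  ... | no  x≉0 = inj₂ (nonzero-cancel x≉0 xy≈0)

  nonzero-product : ∀ {x y} → x ≉ 0# → y ≉ 0# → x * y ≉ 0#
  nonzero-product x≉0 y≉0 = [ x≉0 , y≉0 ] ∘ zero-product

  opaque
    x-y≈0⇒x≈y : ∀ {x y} → x - y ≈ 0# → x ≈ y
    x-y≈0⇒x≈y {x} {y} eq = by-combination eq
      (solve 2 (λ x y → x :+ :0 := y :+ (x :- y)) refl x y)

    *-cancelˡ-nonzero : ∀ {x y z} → x ≉ 0# → x * y ≈ x * z → y ≈ z
    *-cancelˡ-nonzero {x} {y} {z} x≉0 xy≈xz = x-y≈0⇒x≈y (nonzero-cancel x≉0 (by-combination xy≈xz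
      (solve 3 (λ x y z → x :* (y :- z) :+ x :* z := :0 :+ x :* y) refl x y z)))

  square-zero : ∀ {x} → x * x ≈ 0# → x ≈ 0#
  square-zero xx≈0 = Sum.reduce (zero-product xx≈0)

  opaque
    equal-squares : ∀ {x y} → x * x ≈ y * y → x ≈ y ⊎ x ≈ - y
    equal-squares {x} {y} xx≈yy = Sum.map x-y≈0⇒x≈y
      (λ eq → by-combination eq (solve 2 (λ x y → x :+ :0 := :- y :+ (x :+ y)) refl x y))
      (zero-product {x - y} {x + y} (by-combination xx≈yy
        (solve 2 (λ x y → (x :- y) :* (x :+ y) :+ y :* y := :0 :+ x :* x) refl x y)))

  opaque
    ≈-⇒-≈ : ∀ {x y} → x ≈ - y → - x ≈ y
    ≈-⇒-≈ {x} {y} x≈-y = by-combination (sym x≈-y)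
      (solve 2 (λ x y → :- x :+ x := y :+ :- y) refl x y)

  ≈0-resp : ∀ {x y} → x ≈ y → x ≈ 0# → y ≈ 0#
  ≈0-resp x≈y = trans (sym x≈y)

  size-≈0 : HasSize (setoid ↾ (_≈ 0#)) 1
  size-≈0 = size-↾-singleton 0# refl (λ x x≈0 → sym x≈0)

  F* : Setoid _ _
  F* = setoid ↾ (_≉ 0#)

  size-F* : ∃ λ n → HasSize F* n × 1 ℕ.+ n ≡ q
  size-F* = size-complement ≈0-resp (_≟ 0#) size-≈0

  module _ {δ : Carrier} (δ-nonSquare : NonSquare δ) where

    δ≉0 : δ ≉ 0#
    δ≉0 δ≈0 = δ-nonSquare 0# (trans (zeroˡ 0#) (sym δ≈0))

    opaque
      -- For y nonzero, x/y would be a square root of δ.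
      anisotropic : ∀ {x y} → x * x ≈ δ * (y * y) → x ≈ 0# × y ≈ 0#
      anisotropic {x} {y} xx≈δyy with y ≟ 0#
      ... | yes y≈0 = square-zero (trans xx≈δyy
        (trans (*-congˡ (trans (*-congʳ y≈0) (zeroˡ y))) (zeroʳ δ))) , y≈0
      ... | no  y≉0 with inverse y y≉0
      ...   | i , yi≈1 = ⊥-elim (δ-nonSquare (x * i) (by-combination
        (+-cong (*-congˡ {i * i} xx≈δyy) (*-congˡ {δ * (1# + y * i)} yi≈1))
        (solve 4 (λ x y i δ →
           x :* i :* (x :* i) :+ (i :* i :* (δ :* (y :* y)) :+ δ :* (:1 :+ y :* i) :* :1) :=
           δ :+ (i :* i :* (x :* x) :+ δ :* (:1 :+ y :* i) :* (y :* i))) refl x y i δ)))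

    -- In characteristic 2 squaring is injective, hence surjective.
    1+1≉0 : 1# + 1# ≉ 0#
    1+1≉0 2≈0 = let y , yy≈δ = injective⇒surjective (λ x → x * x) (λ x≈y → *-cong x≈y x≈y)
                                  square-injective δ
                in δ-nonSquare y yy≈δ
      where
      square-injective : ∀ {x y} → x * x ≈ y * y → x ≈ y
      square-injective {x} {y} xx≈yy with equal-squares xx≈yy
      ... | inj₁ x≈y  = x≈y
      ... | inj₂ x≈-y = by-combination (+-cong x≈-y (*-congˡ {y} (sym 2≈0)))
        (solve 2 (λ x y → x :+ (:- y :+ y :* (:1 :+ :1)) := y :+ (x :+ y :* :0))
          refl x y)

    -- Choosing x ↦ x² on one half of F and x ↦ δx² on the other gives an
    -- injection, hence a surjection.
    opaque
      square-or-δ-square : ∀ d → ∃ λ x → x * x ≈ d ⊎ δ * (x * x) ≈ d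
      square-or-δ-square d = let x , eq = preimage in x , choose-either (x ≺? (- x)) eq
        where
        choose : ∀ x → Dec (x ≺ - x) → Carrier
        choose x (yes _) = x * x
        choose x (no  _) = δ * (x * x)

        choose-cong : ∀ {x y} x? y? → x ≈ y → choose x x? ≈ choose y y?
        choose-cong (yes _) (yes _) x≈y = *-cong x≈y x≈y
        choose-cong (yes x≺) (no y⊀) x≈y = ⊥-elim (y⊀ (≺-resp-≈ x≈y (-‿cong x≈y) x≺))
        choose-cong (no x⊀) (yes y≺) x≈y = ⊥-elim (x⊀ (≺-resp-≈ (sym x≈y) (-‿cong (sym x≈y)) y≺))
        choose-cong (no _) (no _) x≈y = *-congˡ (*-cong x≈y x≈y)

        -- By `anisotropic` the two kinds of values meet only in 0, where x and y agree.
        mixed : ∀ {x y} → x * x ≈ δ * (y * y) → x ≈ y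
        mixed xx≈δyy with anisotropic xx≈δyy
        ... | x≈0 , y≈0 = trans x≈0 (sym y≈0)

        choose-injective : ∀ {x y} x? y? → choose x x? ≈ choose y y? → x ≈ y
        choose-injective (yes x≺) (yes y≺) eq with equal-squares eq
        ... | inj₁ x≈y  = x≈y
        ... | inj₂ x≈-y = ⊥-elim (≺-asym x≺ (≺-resp-≈ (sym (≈-⇒-≈ x≈-y)) (sym x≈-y) y≺))
        choose-injective (yes _) (no _) eq = mixed eq
        choose-injective (no _) (yes _) eq = sym (mixed (sym eq))
        choose-injective {x} {y} (no x⊀) (no y⊀) eq with equal-squares (*-cancelˡ-nonzero δ≉0 eq)
        ... | inj₁ x≈y  = x≈y
        ... | inj₂ x≈-y with x ≟ - x
        ...   | yes x≈-x = trans x≈-x (≈-⇒-≈ x≈-y)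
        -- Of x and -x, if distinct, one precedes the other; as x does not precede -x, y = -x
        -- precedes -y = x.
        ...   | no  x≉-x = ⊥-elim (y⊀ (≺-resp-≈ (≈-⇒-≈ x≈-y) x≈-y (⊀⇒≻ x≉-x x⊀)))

        preimage : ∃ λ x → choose x (x ≺? (- x)) ≈ d
        preimage = injective⇒surjective (λ x → choose x (x ≺? (- x)))
          (λ {x} {y} → choose-cong (x ≺? (- x)) (y ≺? (- y)))
          (λ {x} {y} → choose-injective (x ≺? (- x)) (y ≺? (- y))) d

        choose-either : ∀ {x} x? → choose x x? ≈ d → x * x ≈ d ⊎ δ * (x * x) ≈ d
        choose-either (yes _) = inj₁
        choose-either (no  _) = inj₂

    -- e is the middle coefficient of a form δY² + eYZ + Z² that splits
    -- into (uY + Z)((e − u)Y + Z).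
    Split : Carrier → Set (c ⊔ ℓ)
    Split e = ∃ λ u → u * u + δ ≈ e * u

    Split-resp : ∀ {e e′} → e ≈ e′ → Split e → Split e′
    Split-resp e≈e′ (u , eq) = u , trans eq (*-congʳ e≈e′)

    split? : ∀ e → Dec (Split e)
    split? e = map′
      (λ (i , eq) → from i , eq)
      (λ (u , eq) → to u , trans
        (+-congʳ (*-cong (strictlyInverseʳ u) (strictlyInverseʳ u)))
        (trans eq (*-congˡ (sym (strictlyInverseʳ u)))))
      (Fin.any? (λ i → from i * from i + δ ≟ e * from i))
      where open Inverse size

    module _ {e : Carrier} (¬split : ¬ Split e) where

      -- e² - 4δ is the discriminant of u² - eu + δ. Were it a square w², (e + w)/2 would be a root;
      -- so it is δw², and w = 0 would leave the root e/2.
      discriminant-δ-square : ∃ λ w → w ≉ 0# × e * e ≈ (1# + 1#) * (1# + 1#) * δ + δ * (w * w)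
      discriminant-δ-square with inverse (1# + 1#) 1+1≉0
        | square-or-δ-square (e * e - (1# + 1#) * (1# + 1#) * δ)
      ... | h , 2h≈1 | w , inj₁ ww≈D = ⊥-elim (¬split (h * (e + w) , by-combination
        -- With w² replaced by e² - 4δ, u² + δ - eu factors as (1 - 2h)t for the t below, which is
        -- therefore the multiplier of 1 = 2h.
        (+-cong (*-congˡ {h * h} ww≈D)
          (*-congˡ {δ * (1# + (1# + 1#) * h) - e * h * (e + w)} (sym 2h≈1)))
        (solve 4 (λ e w h δ → let 2# = :1 :+ :1
                                  u = h :* (e :+ w)
                                  t = δ :* (:1 :+ 2# :* h) :- e :* h :* (e :+ w) in
          (u :* u :+ δ) :+ (h :* h :* (e :* e :- 2# :* 2# :* δ) :+ t :* (2# :* h)) :=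
          e :* u :+ (h :* h :* (w :* w) :+ t :* :1)) refl e w h δ)))
      ... | h , 2h≈1 | w , inj₂ δww≈D = w , w≉0 , by-combination (sym δww≈D)
        (solve 3 (λ e w δ → let 2# = :1 :+ :1 in
          e :* e :+ δ :* (w :* w) :=
          2# :* 2# :* δ :+ δ :* (w :* w) :+ (e :* e :- 2# :* 2# :* δ)) refl e w δ)
        where
        w≉0 : w ≉ 0#
        w≉0 w≈0 = ¬split (h * e , by-combination
          (+-cong (*-congˡ {h * h} δww≈D) (+-cong (*-congˡ {h * h * δ * w} (sym w≈0))
            (*-congˡ {δ * (1# + (1# + 1#) * h) - e * h * e} (sym 2h≈1))))
          (solve 4 (λ e w h δ → let 2# = :1 :+ :1
                                    u = h :* e
                                    t = δ :* (:1 :+ 2# :* h) :- e :* h :* e in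
            (u :* u :+ δ) :+
              (h :* h :* (e :* e :- 2# :* 2# :* δ) :+ (h :* h :* δ :* w :* w :+ t :* (2# :* h))) :=
            e :* u :+ (h :* h :* (δ :* (w :* w)) :+ (h :* h :* δ :* w :* :0 :+ t :* :1)))
            refl e w h δ))

    opaque

      -- The roots of t² - et + δ have product δ, so δ/u is the root that accompanies u; the two
      -- coincide only if u² = δ.
      quotient-δ : ∃ (_≉ 0#) → ∃ (_≉ 0#)
      quotient-δ (u , u≉0) = let i , ui≈1 = inverse u u≉0 in
        δ * i , nonzero-product δ≉0 (λ i≈0 → 1≉0 (trans (sym ui≈1) (trans (*-congˡ i≈0) (zeroʳ u))))

      quotient-δ-correct : ∀ u → proj₁ u * proj₁ (quotient-δ u) ≈ δ
      quotient-δ-correct (u , u≉0) = let i , ui≈1 = inverse u u≉0 in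
        by-combination (*-congˡ {δ} ui≈1)
          (solve 3 (λ u i δ → u :* (δ :* i) :+ δ :* :1 := δ :+ δ :* (u :* i)) refl u i δ)

    quotient-δ-unique : ∀ u {v} → proj₁ u * v ≈ δ → proj₁ (quotient-δ u) ≈ v
    quotient-δ-unique u uv≈δ = *-cancelˡ-nonzero (proj₂ u) (trans (quotient-δ-correct u) (sym uv≈δ))

    quotient-δ-cong : ∀ {u v} → proj₁ u ≈ proj₁ v → proj₁ (quotient-δ u) ≈ proj₁ (quotient-δ v)
    quotient-δ-cong {u} {v} u≈v = quotient-δ-unique u (trans (*-congʳ u≈v) (quotient-δ-correct v))

    quotient-δ-involutive : ∀ u → proj₁ (quotient-δ (quotient-δ u)) ≈ proj₁ u
    quotient-δ-involutive u = quotient-δ-unique (quotient-δ u)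
      (trans (*-comm _ _) (quotient-δ-correct u))

    quotient-δ-fixed-point-free : ∀ u → ¬ proj₁ u ≈ proj₁ (quotient-δ u)
    quotient-δ-fixed-point-free u eq =
      δ-nonSquare (proj₁ u) (trans (*-congˡ eq) (quotient-δ-correct u))

    module Roots {n : ℕ} (F*↔n : HasSize F* n) where

      module F* = Finite F* F*↔n

      Smaller : ∃ (_≉ 0#) → Set
      Smaller u = u F*.≺ quotient-δ u

      Representative : Set _
      Representative = ∃ Smaller

      -- The e whose two roots are u and δ/u; keeping only the smaller root of each pair makes this
      -- injective.
      root-sum : Representative → Carrier
      root-sum (u , _) = proj₁ u + proj₁ (quotient-δ u)

      opaque
        root-sum-split : ∀ u → Split (root-sum u)
        root-sum-split ((u , u≉0) , _) = u , by-combination (sym (quotient-δ-correct (u , u≉0)))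
          (solve 3 (λ u u′ δ → u :* u :+ δ :+ u :* u′ := (u :+ u′) :* u :+ δ)
            refl u (proj₁ (quotient-δ (u , u≉0))) δ)

        -- By the hypotheses, (u - v)(u - v′) equals u² - (u + u′)u + uu′ = 0.
        equal-sums : ∀ {u u′ v v′} → u * u′ ≈ δ → v * v′ ≈ δ → u + u′ ≈ v + v′ → u ≈ v ⊎ u ≈ v′
        equal-sums {u} {u′} {v} {v′} uu′≈δ vv′≈δ eq =
          Sum.map x-y≈0⇒x≈y x-y≈0⇒x≈y (zero-product (by-combination
          (+-cong (*-congˡ {u} eq) (+-cong vv′≈δ (sym uu′≈δ)))
          (solve 5 (λ u u′ v v′ δ →
            (u :- v) :* (u :- v′) :+ (u :* (v :+ v′) :+ (δ :+ u :* u′)) :=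
            :0 :+ (u :* (u :+ u′) :+ (v :* v′ :+ δ))) refl u u′ v v′ δ)))

        complementary-root : ∀ u {e} → proj₁ u * proj₁ u + δ ≈ e * proj₁ u →
          proj₁ u + proj₁ (quotient-δ u) ≈ e
        complementary-root u {e} eq = *-cancelˡ-nonzero (proj₂ u) (by-combination
          (+-cong eq (quotient-δ-correct u))
          (solve 4 (λ u u′ e δ →
            u :* (u :+ u′) :+ (e :* u :+ δ) := u :* e :+ (u :* u :+ δ :+ u :* u′))
            refl (proj₁ u) (proj₁ (quotient-δ u)) e δ))

      root-sum-injective : ∀ {u v} → root-sum u ≈ root-sum v → proj₁ (proj₁ u) ≈ proj₁ (proj₁ v)
      root-sum-injective {u , u≺} {v , v≺} eq
        with equal-sums (quotient-δ-correct u) (quotient-δ-correct v) eq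
      ... | inj₁ u≈v  = u≈v
      ... | inj₂ u≈v′ = ⊥-elim (F*.≺-asym {v} {quotient-δ v} v≺
        (F*.≺-resp-≈ {u} {quotient-δ v} {quotient-δ u} {v} u≈v′
          (trans (quotient-δ-cong u≈v′) (quotient-δ-involutive v)) u≺))

      -- A root u of e is nonzero because δ is, and whichever of u and δ/u is smaller represents e.
      root-sum-surjective : ((e , _) : ∃ Split) → ∃ λ u → root-sum u ≈ e
      root-sum-surjective (e , u , eq) = choose (u* F*.≺? quotient-δ u*)
        where
        u≉0 : u ≉ 0#
        u≉0 u≈0 = δ≉0 (by-combination (+-cong eq (*-congˡ {e - u} u≈0))
          (solve 3 (λ u e δ → δ :+ (e :* u :+ (e :- u) :* :0) :=
            :0 :+ (u :* u :+ δ :+ (e :- u) :* u)) refl u e δ))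

        u* : ∃ (_≉ 0#)
        u* = u , u≉0

        u′* = quotient-δ u*

        choose : Dec (Smaller u*) → ∃ λ u → root-sum u ≈ e
        choose (yes u≺) = (u* , u≺) , complementary-root u* eq
        choose (no  u⊀) =
          (u′* , F*.≺-resp-≈ {u′*} {u′*} {u*} {quotient-δ u′*} refl (sym (quotient-δ-involutive u*))
            (F*.⊀⇒≻ {u*} {u′*} (quotient-δ-fixed-point-free u*) u⊀)) ,
          trans (+-congˡ (quotient-δ-involutive u*)) (trans (+-comm _ _) (complementary-root u* eq))

      size-Split : ∃ λ k → HasSize (setoid ↾ Split) k × k ℕ.+ k ≡ n
      size-Split =
        let k , orbits↔k , k+k≡n = F*.size-involution quotient-δ
              (λ {u} {v} → quotient-δ-cong {u} {v}) quotient-δ-involutive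
              quotient-δ-fixed-point-free
        in k , size-resp (bijection⇒inverse (F* ↾ Smaller) (setoid ↾ Split)
             (λ u → root-sum u , root-sum-split u)
             (λ {(u , _)} {(v , _)} u≈v → +-cong u≈v (quotient-δ-cong {u} {v} u≈v))
             (λ {u} {v} → root-sum-injective {u} {v})
             root-sum-surjective) orbits↔k , k+k≡n

    -- k is (q - 1)/2, the number of pairs u, δ/u in `F*`; the non-split e then number q - k = k +
    -- 1. Writing q as 1 + (k + k) postpones all division by 2.
    sizes : ∃ λ k → 1 ℕ.+ (k ℕ.+ k) ≡ q × HasSize F* (k ℕ.+ k) ×
      HasSize (setoid ↾ Split) k × HasSize (setoid ↾ ¬_ ∘ Split) (suc k)
    sizes =
      let n , F*↔n , 1+n≡q = size-F*
          k , S↔k , k+k≡n = Roots.size-Split F*↔n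
          m , ¬S↔m , k+m≡q = size-complement Split-resp split? S↔k
          1+2k≡q = ≡.trans (≡.cong suc k+k≡n) 1+n≡q
      in k , 1+2k≡q , ≡.subst (HasSize F*) (≡.sym k+k≡n) F*↔n , S↔k ,
         ≡.subst (HasSize (setoid ↾ ¬_ ∘ Split))
           (ℕ.+-cancelˡ-≡ k m (suc k) (≡.trans k+m≡q (≡.trans (≡.sym 1+2k≡q) (≡.sym (ℕ.+-suc k k)))))
           ¬S↔m

-- Ternary quadratic forms under linear substitutions

-- Instantiated at the polynomials of the ring solver and at scalars, where _⊙_, disc and
-- mul agree definitionally with formProduct, discriminant and _*ₘ_.
module FormOperations {A : Set c} (_+_ _*_ _-_ : A → A → A) (0# : A) where

  open import Data.Vec.Functional using (Vector; []; _∷_; transpose)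
  private
    infixl 7 _⋆_
    infixl 6 _⊹_ _⊖_
    _⊹_ = _+_
    _⋆_ = _*_
    _⊖_ = _-_

  dot : Vector A 3 → Vector A 3 → A
  dot l v = l 0F ⋆ v 0F ⊹ (l 1F ⋆ v 1F ⊹ (l 2F ⋆ v 2F ⊹ 0#))

  -- Nesting and final zero are those of `sum`, so that the condition in `_⊆_` is this expression
  -- definitionally.
  pairing : Vector A 6 → Vector A 6 → A
  pairing a y =
    a 0F ⋆ y 0F ⊹ (a 1F ⋆ y 1F ⊹ (a 2F ⋆ y 2F ⊹ (a 3F ⋆ y 3F ⊹ (a 4F ⋆ y 4F ⊹ (a 5F ⋆ y 5F ⊹ 0#)))))

  infixl 8 _▷_
  _▷_ : Vector A 3 → Vector (Vector A 3) 3 → Vector A 3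
  (l ▷ M) j = dot l (λ i → M i j)

  mul : (M N : Vector (Vector A 3) 3) → Vector (Vector A 3) 3
  mul M N i = M i ▷ N

  infixl 7 _⊙_
  _⊙_ : Vector A 3 → Vector A 3 → Vector A 6
  l ⊙ m =
    l 0F ⋆ m 0F ∷
    l 0F ⋆ m 1F ⊹ l 1F ⋆ m 0F ∷
    l 0F ⋆ m 2F ⊹ l 2F ⋆ m 0F ∷
    l 1F ⋆ m 1F ∷
    l 1F ⋆ m 2F ⊹ l 2F ⋆ m 1F ∷
    l 2F ⋆ m 2F ∷ []

  -- The substitution turns XᵢXⱼ into the product of rows i and j; these are the coefficients at the
  -- k-th monomial of the six products.
  coefficients : Vector (Vector A 3) 3 → Fin 6 → Vector A 6
  coefficients M k =
    (M 0F ⊙ M 0F) k ∷ (M 0F ⊙ M 1F) k ∷ (M 0F ⊙ M 2F) k ∷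
    (M 1F ⊙ M 1F) k ∷ (M 1F ⊙ M 2F) k ∷ (M 2F ⊙ M 2F) k ∷ []

  -- The form a(X) after the substitution X ↦ MX: the form Xᵢ becomes row i of M.
  act : Vector (Vector A 3) 3 → Vector A 6 → Vector A 6
  act M a k = pairing a (coefficients M k)

  symmetric : Vector A 6 → Vector (Vector A 3) 3
  symmetric y =
    (y 0F ∷ y 1F ∷ y 2F ∷ []) ∷
    (y 1F ∷ y 3F ∷ y 4F ∷ []) ∷
    (y 2F ∷ y 4F ∷ y 5F ∷ []) ∷ []

  upper : Vector (Vector A 3) 3 → Vector A 6
  upper M = M 0F 0F ∷ M 0F 1F ∷ M 0F 2F ∷ M 1F 1F ∷ M 1F 2F ∷ M 2F 2F ∷ []

  -- The action of M on points of PG(5,q); the product is symmetric, so its upper triangle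
  -- determines it.
  congruence : Vector (Vector A 3) 3 → Vector A 6 → Vector A 6
  congruence M y = upper (mul (mul M (symmetric y)) (transpose M))

  det : Vector (Vector A 3) 3 → A
  det M =
    M 0F 0F ⋆ (M 1F 1F ⋆ M 2F 2F ⊖ M 1F 2F ⋆ M 2F 1F) ⊖
    M 0F 1F ⋆ (M 1F 0F ⋆ M 2F 2F ⊖ M 1F 2F ⋆ M 2F 0F) ⊹
    M 0F 2F ⋆ (M 1F 0F ⋆ M 2F 1F ⊖ M 1F 1F ⋆ M 2F 0F)

  disc : Vector A 6 → A
  disc a =
    (x ⊹ (x ⊹ (x ⊹ (x ⊹ 0#)))) ⊹ a 1F ⋆ a 2F ⋆ a 4F
      ⊖ a 0F ⋆ (a 4F ⋆ a 4F) ⊖ a 3F ⋆ (a 2F ⋆ a 2F) ⊖ a 5F ⋆ (a 1F ⋆ a 1F)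
    where
    x = a 0F ⋆ a 3F ⋆ a 5F

module Action {q : ℕ} (F : FiniteField c ℓ q) where

  open import Data.Vec.Functional using (Vector)
  open FiniteField F
  open FieldProperties F
  open ProjectiveGeometry F
  open VectorEquality setoid using (_≋_)
  open FormOperations _+_ _*_ _-_ 0# public
  module P {n} = FormOperations {A = Polynomial n} _:+_ _:*_ _:-_ :0

  -- vec₃ i, mat i and vec₆ i are the variables occupying positions i, i + 1, … of an
  -- environment built by _++ᵥ_, _++ₘ_ and _++₆_.
  infixr 5 _++ᵥ_ _++ₘ_ _++₆_
  _++ᵥ_ : ∀ {n} → Vector Carrier 3 → Vec Carrier n → Vec Carrier (3 ℕ.+ n)
  l ++ᵥ ρ = l 0F Vec.∷ l 1F Vec.∷ l 2F Vec.∷ ρ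

  _++ₘ_ : ∀ {n} → Vector (Vector Carrier 3) 3 → Vec Carrier n → Vec Carrier (9 ℕ.+ n)
  M ++ₘ ρ = M 0F ++ᵥ M 1F ++ᵥ M 2F ++ᵥ ρ

  _++₆_ : ∀ {n} → Vector Carrier 6 → Vec Carrier n → Vec Carrier (6 ℕ.+ n)
  a ++₆ ρ = a 0F Vec.∷ a 1F Vec.∷ a 2F Vec.∷ a 3F Vec.∷ a 4F Vec.∷ a 5F Vec.∷ ρ

  vec₃ : ∀ {n} i → Vector (Polynomial (i ℕ.+ (3 ℕ.+ n))) 3
  vec₃ i j = var (i ↑ʳ (j ↑ˡ _))

  mat : ∀ {n} i → Vector (Vector (Polynomial (i ℕ.+ (9 ℕ.+ n))) 3) 3
  mat i 0F j = var (i ↑ʳ (j ↑ˡ _))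
  mat i 1F j = var (i ↑ʳ (3 ↑ʳ (j ↑ˡ _)))
  mat i 2F j = var (i ↑ʳ (6 ↑ʳ (j ↑ˡ _)))

  vec₆ : ∀ {n} i → Vector (Polynomial (i ℕ.+ (6 ℕ.+ n))) 6
  vec₆ i j = var (i ↑ʳ (j ↑ˡ _))

  1ₚ : ∀ {n} → Vector (Vector (Polynomial n) 3) 3
  1ₚ i j = if does (i Fin.≟ j) then :1 else :0

  opaque
    -- `disc` is 4 times the determinant of the symmetric matrix of the form, and a substitution
    -- replaces that matrix by a congruent one.
    disc-act : ∀ M a → disc (act M a) ≈ det M * det M * disc a
    disc-act M a = prove (M ++ₘ a ++₆ Vec.[]) (P.disc (P.act (mat 0) (vec₆ 9)))
      (P.det (mat 0) :* P.det (mat 0) :* P.disc (vec₆ 9)) refl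

    act-⊙ : ∀ M l m → act M (l ⊙ m) ≋ (l ▷ M) ⊙ (m ▷ M)
    act-⊙ M l m = λ
      { 0F → prove ρ (x 0F) (y 0F) refl
      ; 1F → prove ρ (x 1F) (y 1F) refl
      ; 2F → prove ρ (x 2F) (y 2F) refl
      ; 3F → prove ρ (x 3F) (y 3F) refl
      ; 4F → prove ρ (x 4F) (y 4F) refl
      ; 5F → prove ρ (x 5F) (y 5F) refl
      }
      where
      ρ : Vec Carrier 15
      ρ = M ++ₘ l ++ᵥ m ++ᵥ Vec.[]
      x y : Vector (Polynomial 15) 6
      x = P.act (mat 0) (vec₃ 9 P.⊙ vec₃ 12)
      y = vec₃ 9 P.▷ mat 0 P.⊙ vec₃ 12 P.▷ mat 0

    -- Substitutions act from the right: (a(MX))(NX) = a(MNX).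
    act-mul : ∀ M N a → act N (act M a) ≋ act (mul M N) a
    act-mul M N a = λ
      { 0F → prove ρ (x 0F) (y 0F) refl
      ; 1F → prove ρ (x 1F) (y 1F) refl
      ; 2F → prove ρ (x 2F) (y 2F) refl
      ; 3F → prove ρ (x 3F) (y 3F) refl
      ; 4F → prove ρ (x 4F) (y 4F) refl
      ; 5F → prove ρ (x 5F) (y 5F) refl
      }
      where
      ρ : Vec Carrier 24
      ρ = M ++ₘ N ++ₘ a ++₆ Vec.[]
      x y : Vector (Polynomial 24) 6
      x = P.act (mat 9) (P.act (mat 0) (vec₆ 18))
      y = P.act (P.mul (mat 0) (mat 9)) (vec₆ 18)

    ⊙-cong : ∀ {l l′ m m′} → l ≋ l′ → m ≋ m′ → l ⊙ m ≋ l′ ⊙ m′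
    ⊙-cong l≋ m≋ = λ
      { 0F → *-cong (l≋ 0F) (m≋ 0F)
      ; 1F → +-cong (*-cong (l≋ 0F) (m≋ 1F)) (*-cong (l≋ 1F) (m≋ 0F))
      ; 2F → +-cong (*-cong (l≋ 0F) (m≋ 2F)) (*-cong (l≋ 2F) (m≋ 0F))
      ; 3F → *-cong (l≋ 1F) (m≋ 1F)
      ; 4F → +-cong (*-cong (l≋ 1F) (m≋ 2F)) (*-cong (l≋ 2F) (m≋ 1F))
      ; 5F → *-cong (l≋ 2F) (m≋ 2F)
      }

    dot-cong : ∀ {l l′ m m′} → l ≋ l′ → m ≋ m′ → dot l m ≈ dot l′ m′
    dot-cong l≋ m≋ = +-cong (*-cong (l≋ 0F) (m≋ 0F)) (+-cong (*-cong (l≋ 1F) (m≋ 1F))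
      (+-congʳ (*-cong (l≋ 2F) (m≋ 2F))))

    pairing-cong : ∀ {a a′ y y′} → a ≋ a′ → y ≋ y′ → pairing a y ≈ pairing a′ y′
    pairing-cong a≋ y≋ = +-cong (*-cong (a≋ 0F) (y≋ 0F)) (+-cong (*-cong (a≋ 1F) (y≋ 1F))
      (+-cong (*-cong (a≋ 2F) (y≋ 2F)) (+-cong (*-cong (a≋ 3F) (y≋ 3F))
      (+-cong (*-cong (a≋ 4F) (y≋ 4F)) (+-congʳ (*-cong (a≋ 5F) (y≋ 5F)))))))

    coefficients-cong : ∀ {M N} → M ≋ₘ N → ∀ k → coefficients M k ≋ coefficients N k
    coefficients-cong M≋N k = λ
      { 0F → ⊙-cong (M≋N 0F) (M≋N 0F) k
      ; 1F → ⊙-cong (M≋N 0F) (M≋N 1F) k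
      ; 2F → ⊙-cong (M≋N 0F) (M≋N 2F) k
      ; 3F → ⊙-cong (M≋N 1F) (M≋N 1F) k
      ; 4F → ⊙-cong (M≋N 1F) (M≋N 2F) k
      ; 5F → ⊙-cong (M≋N 2F) (M≋N 2F) k
      }

    act-cong : ∀ {M N a b} → M ≋ₘ N → a ≋ b → act M a ≋ act N b
    act-cong M≋N a≋b k = pairing-cong a≋b (coefficients-cong M≋N k)

    act-congˡ : ∀ {M N} a → M ≋ₘ N → act M a ≋ act N a
    act-congˡ a M≋N = act-cong {b = a} M≋N (λ _ → refl)

    act-congʳ : ∀ M {a b} → a ≋ b → act M a ≋ act M b
    act-congʳ M = act-cong {M} {M} λ _ _ → refl

    pairing-congˡ : ∀ {a a′} y → a ≋ a′ → pairing a y ≈ pairing a′ y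
    pairing-congˡ y a≋ = pairing-cong {y = y} a≋ (λ _ → refl)

    pairing-congʳ : ∀ a {y y′} → y ≋ y′ → pairing a y ≈ pairing a y′
    pairing-congʳ a = pairing-cong {a} (λ _ → refl)

    act-1 : ∀ a → act 1ₘ a ≋ a
    act-1 a = λ
      { 0F → prove ρ (x 0F) (y 0F) refl
      ; 1F → prove ρ (x 1F) (y 1F) refl
      ; 2F → prove ρ (x 2F) (y 2F) refl
      ; 3F → prove ρ (x 3F) (y 3F) refl
      ; 4F → prove ρ (x 4F) (y 4F) refl
      ; 5F → prove ρ (x 5F) (y 5F) refl
      }
      where
      ρ : Vec Carrier 6
      ρ = a ++₆ Vec.[]
      x y : Vector (Polynomial 6) 6
      x = P.act 1ₚ (vec₆ 0)
      y = vec₆ 0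

    -- For fixed k the action is a pairing with a fixed vector, whose six entries stay unknowns for
    -- the solver. The combination is the one occurring in `normForm`.
    act-combination : ∀ M s t a b →
      act M (λ i → s * (a i - t * b i)) ≋ λ i → s * (act M a i - t * act M b i)
    act-combination M s t a b k =
      prove (s Vec.∷ t Vec.∷ (a ++₆ b ++₆ coefficients M k ++₆ Vec.[]))
        (P.pairing (λ i → var 0F :* (vec₆ 2 i :- var 1F :* vec₆ 8 i)) (vec₆ 14))
        (var 0F :* (P.pairing (vec₆ 2) (vec₆ 14) :- var 1F :* P.pairing (vec₆ 8) (vec₆ 14))) refl

    act-scale : ∀ M s a → act M (λ i → s * a i) ≋ λ i → s * act M a i
    act-scale M s a k = prove (s Vec.∷ (a ++₆ coefficients M k ++₆ Vec.[]))
      (P.pairing (λ i → var 0F :* vec₆ 1 i) (vec₆ 7))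
      (var 0F :* P.pairing (vec₆ 1) (vec₆ 7)) refl

    pairing-scaleʳ : ∀ s a y → pairing a (λ i → s * y i) ≈ s * pairing a y
    pairing-scaleʳ s a y = prove (s Vec.∷ (a ++₆ y ++₆ Vec.[]))
      (P.pairing (vec₆ 1) (λ i → var 0F :* vec₆ 7 i))
      (var 0F :* P.pairing (vec₆ 1) (vec₆ 7)) refl

    ▷-mul : ∀ l M N → l ▷ M ▷ N ≋ l ▷ mul M N
    ▷-mul l M N k = prove (l ++ᵥ (M ++ₘ ((λ i → N i k) ++ᵥ Vec.[])))
      (P.dot (vec₃ 0 P.▷ mat 3) (vec₃ 12))
      (P.dot (vec₃ 0) (λ i → P.dot (mat 3 i) (vec₃ 12))) refl

    ▷-congˡ : ∀ {l m} M → l ≋ m → l ▷ M ≋ m ▷ M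
    ▷-congˡ M l≋m j = dot-cong {m = λ i → M i j} l≋m (λ _ → refl)

    ▷-congʳ : ∀ l {M N} → M ≋ₘ N → l ▷ M ≋ l ▷ N
    ▷-congʳ l M≋N j = dot-cong {l} (λ _ → refl) (λ i → M≋N i j)

    ▷-1 : ∀ l → l ▷ 1ₘ ≋ l
    ▷-1 l = λ
      { 0F → prove ρ (x 0F) (y 0F) refl
      ; 1F → prove ρ (x 1F) (y 1F) refl
      ; 2F → prove ρ (x 2F) (y 2F) refl
      }
      where
      ρ : Vec Carrier 3
      ρ = l ++ᵥ Vec.[]
      x y : Vector (Polynomial 3) 3
      x = vec₃ 0 P.▷ 1ₚ
      y = vec₃ 0

    ▷-linear : ∀ M p r l m → (λ i → p * l i + r * m i) ▷ M ≋ λ j → p * (l ▷ M) j + r * (m ▷ M) j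
    ▷-linear M p r l m j = prove (p Vec.∷ r Vec.∷ (l ++ᵥ (m ++ᵥ ((λ i → M i j) ++ᵥ Vec.[]))))
      (P.dot (λ i → var 0F :* vec₃ 2 i :+ var 1F :* vec₃ 5 i) (vec₃ 8))
      (var 0F :* P.dot (vec₃ 2) (vec₃ 8) :+ var 1F :* P.dot (vec₃ 5) (vec₃ 8)) refl

    ▷-scale : ∀ M s l → (λ i → s * l i) ▷ M ≋ λ j → s * (l ▷ M) j
    ▷-scale M s l j = prove (s Vec.∷ (l ++ᵥ ((λ i → M i j) ++ᵥ Vec.[])))
      (P.dot (λ i → var 0F :* vec₃ 1 i) (vec₃ 4))
      (var 0F :* P.dot (vec₃ 1) (vec₃ 4)) refl

    disc-⊙ : ∀ l m → disc (l ⊙ m) ≈ 0#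
    disc-⊙ l m = prove (l ++ᵥ m ++ᵥ Vec.[]) (P.disc (vec₃ 0 P.⊙ vec₃ 3)) :0 refl

    disc-scale : ∀ s a → disc (λ i → s * a i) ≈ s * s * s * disc a
    disc-scale s a = prove (s Vec.∷ (a ++₆ Vec.[])) (P.disc (λ i → var 0F :* vec₆ 1 i))
      (var 0F :* var 0F :* var 0F :* P.disc (vec₆ 1)) refl

    disc-cong : ∀ {a b} → a ≋ b → disc a ≈ disc b
    disc-cong {a} {b} a≋b = +-cong (+-cong (+-cong (+-cong
      (+-cong x≈y (+-cong x≈y (+-cong x≈y (+-congʳ x≈y))))
      (*-cong (*-cong (a≋b 1F) (a≋b 2F)) (a≋b 4F)))
      (-‿cong (*-cong (a≋b 0F) (*-cong (a≋b 4F) (a≋b 4F)))))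
      (-‿cong (*-cong (a≋b 3F) (*-cong (a≋b 2F) (a≋b 2F)))))
      (-‿cong (*-cong (a≋b 5F) (*-cong (a≋b 1F) (a≋b 1F))))
      where
      x≈y : a 0F * a 3F * a 5F ≈ b 0F * b 3F * b 5F
      x≈y = *-cong (*-cong (a≋b 0F) (a≋b 3F)) (a≋b 5F)

    -- Adjointness of the two actions: on a rank-one point y = vvᵗ both sides are the value a(Mv).
    pairing-act : ∀ M a y → pairing a (congruence M y) ≈ pairing (act M a) y
    pairing-act M a y = prove (M ++ₘ a ++₆ y ++₆ Vec.[])
      (P.pairing (vec₆ 9) (P.congruence (mat 0) (vec₆ 15)))
      (P.pairing (P.act (mat 0) (vec₆ 9)) (vec₆ 15)) refl

-- GL(3,q) on forms and points, and incidence with the line L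

module GroupAction {q : ℕ} (F : FiniteField c ℓ q) where

  open import Data.Vec.Functional using (Vector; []; _∷_; transpose)
  open FiniteField F
  open FieldProperties F
  open ProjectiveGeometry F
  open VectorEquality setoid using (_≋_; ≋-sym; ≋-trans)
  open Action F

  inverseᴳ : GL₃ → GL₃
  inverseᴳ (A , B , AB≋1 , BA≋1) = B , A , BA≋1 , AB≋1

  opaque
    act-inverse : ((A , B , _) : GL₃) → ∀ a → act B (act A a) ≋ a
    act-inverse (A , B , AB≋1 , _) a =
      ≋-trans (act-mul A B a) (≋-trans (act-congˡ a AB≋1) (act-1 a))

    ▷-inverse : ((A , B , _) : GL₃) → ∀ l → l ▷ A ▷ B ≋ l
    ▷-inverse (A , B , AB≋1 , _) l = ≋-trans (▷-mul l A B) (≋-trans (▷-congʳ l AB≋1) (▷-1 l))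

  0ᵥ : ∀ {n} → Vector Carrier n
  0ᵥ _ = 0#

  -- Zero written as a zero multiple, so that the scaling lemmas yield the images of the zero
  -- vector.
  0*0ᵥ : ∀ {n} → 0ᵥ {n} ≋ λ _ → 0# * 0#
  0*0ᵥ _ = sym (zeroˡ 0#)

  act-zero : ∀ M → act M 0ᵥ ≋ 0ᵥ
  act-zero M = ≋-trans (act-congʳ M 0*0ᵥ) (≋-trans (act-scale M 0# 0ᵥ) (λ _ → zeroˡ _))

  ▷-zero : ∀ M → 0ᵥ ▷ M ≋ 0ᵥ
  ▷-zero M = ≋-trans (▷-congˡ M 0*0ᵥ) (≋-trans (▷-scale M 0# 0ᵥ) (λ _ → zeroˡ _))

  act≋0⇒≋0 : ∀ (g : GL₃) {a} → act (proj₁ g) a ≋ 0ᵥ → a ≋ 0ᵥ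
  act≋0⇒≋0 g@(A , B , _) {a} eq =
    ≋-trans (≋-sym (act-inverse g a)) (≋-trans (act-congʳ B eq) (act-zero B))

  ▷≋0⇒≋0 : ∀ (g : GL₃) {l} → l ▷ proj₁ g ≋ 0ᵥ → l ≋ 0ᵥ
  ▷≋0⇒≋0 g@(A , B , _) {l} eq =
    ≋-trans (≋-sym (▷-inverse g l)) (≋-trans (▷-congˡ B eq) (▷-zero B))

  infixr 8 _•_
  _•_ : GL₃ → Hyperplane → Hyperplane
  g@(A , _) • (a , a≉0) = act A a , a≉0 ∘ act≋0⇒≋0 g

  _◂_ : LinearForm → GL₃ → LinearForm
  (l , l≉0) ◂ g@(A , _) = l ▷ A , l≉0 ∘ ▷≋0⇒≋0 g

  •-∼ : ∀ g {a b} → proj₁ a ∼ proj₁ b → proj₁ (g • a) ∼ proj₁ (g • b)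
  •-∼ (A , _) {a , _} (s , s≉0 , b≋sa) =
    s , s≉0 , ≋-trans (act-congʳ A b≋sa) (act-scale A s a)

  ◂-∼ : ∀ (g : GL₃) {l m} → l ▷ proj₁ g ∼ m ▷ proj₁ g → l ∼ m
  ◂-∼ g@(A , B , _) {l} {m} (s , s≉0 , eq) = s , s≉0 ,
    ≋-trans (≋-sym (▷-inverse g m)) (≋-trans (▷-congˡ B eq)
      (≋-trans (▷-scale B s (l ▷ A)) (λ i → *-congˡ (▷-inverse g l i))))

  •-inverse : ∀ g a → proj₁ (inverseᴳ g • g • a) ∼ proj₁ a
  •-inverse g a = 1# , 1≉0 , λ i → trans (sym (act-inverse g (proj₁ a) i)) (sym (*-identityˡ _))

  -- By adjointness, a point annihilated by all hyperplanes after the congruence was already zero.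
  congruence≋0⇒≋0 : ∀ (g : GL₃) y → congruence (proj₁ g) y ≋ 0ᵥ → y ≋ 0ᵥ
  congruence≋0⇒≋0 g@(A , B , _) y eq i = begin
    y i                                      ≈⟨ coordinate i ⟨
    pairing (basis i) y                      ≈⟨ pairing-congˡ y (act-inverse (inverseᴳ g) (basis i)) ⟨
    pairing (act A (act B (basis i))) y      ≈⟨ pairing-act A (act B (basis i)) y ⟨
    pairing (act B (basis i)) (congruence A y)   ≈⟨ pairing-congʳ (act B (basis i)) (≋-trans eq 0*0ᵥ) ⟩
    pairing (act B (basis i)) (λ _ → 0# * 0#)  ≈⟨ pairing-scaleʳ 0# (act B (basis i)) 0ᵥ ⟩
    0# * pairing (act B (basis i)) 0ᵥ        ≈⟨ zeroˡ _ ⟩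
    0#                                       ∎
    where
    open SetoidReasoning setoid

    basis : Fin 6 → Vector Carrier 6
    basis 0F = 1# ∷ 0# ∷ 0# ∷ 0# ∷ 0# ∷ 0# ∷ []
    basis 1F = 0# ∷ 1# ∷ 0# ∷ 0# ∷ 0# ∷ 0# ∷ []
    basis 2F = 0# ∷ 0# ∷ 1# ∷ 0# ∷ 0# ∷ 0# ∷ []
    basis 3F = 0# ∷ 0# ∷ 0# ∷ 1# ∷ 0# ∷ 0# ∷ []
    basis 4F = 0# ∷ 0# ∷ 0# ∷ 0# ∷ 1# ∷ 0# ∷ []
    basis 5F = 0# ∷ 0# ∷ 0# ∷ 0# ∷ 0# ∷ 1# ∷ []

    opaque
      coordinate : ∀ i → pairing (basis i) y ≈ y i
      coordinate = λ
        { 0F → prove ρ (P.pairing (:1 ∷ :0 ∷ :0 ∷ :0 ∷ :0 ∷ :0 ∷ []) (vec₆ 0)) (vec₆ 0 0F) refl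
        ; 1F → prove ρ (P.pairing (:0 ∷ :1 ∷ :0 ∷ :0 ∷ :0 ∷ :0 ∷ []) (vec₆ 0)) (vec₆ 0 1F) refl
        ; 2F → prove ρ (P.pairing (:0 ∷ :0 ∷ :1 ∷ :0 ∷ :0 ∷ :0 ∷ []) (vec₆ 0)) (vec₆ 0 2F) refl
        ; 3F → prove ρ (P.pairing (:0 ∷ :0 ∷ :0 ∷ :1 ∷ :0 ∷ :0 ∷ []) (vec₆ 0)) (vec₆ 0 3F) refl
        ; 4F → prove ρ (P.pairing (:0 ∷ :0 ∷ :0 ∷ :0 ∷ :1 ∷ :0 ∷ []) (vec₆ 0)) (vec₆ 0 4F) refl
        ; 5F → prove ρ (P.pairing (:0 ∷ :0 ∷ :0 ∷ :0 ∷ :0 ∷ :1 ∷ []) (vec₆ 0)) (vec₆ 0 5F) refl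
        }
        where
        ρ : Vec Carrier 6
        ρ = y ++₆ Vec.[]

  congruencePoint : GL₃ → Point 5 → Point 5
  congruencePoint g@(A , _) (y , y≉0) = congruence A y , y≉0 ∘ congruence≋0⇒≋0 g y

  private
    pABAᵗ : Vector (Vector (Polynomial 15) 3) 3
    pABAᵗ = P.mul (P.mul (mat 0) (P.symmetric (vec₆ 9))) (transpose (mat 0))

  opaque
    -- Only the entries below the diagonal, discarded by `upper`, require the symmetry of AyAᵗ.
    congruence-symmetric : ∀ A y → symmetric (congruence A y) ≋ₘ A *ₘ symmetric y *ₘ transpose A
    congruence-symmetric A y = λ
      { 0F → λ { 0F → refl ; 1F → refl ; 2F → refl }
      ; 1F → λ { 0F → prove ρ (pABAᵗ 0F 1F) (pABAᵗ 1F 0F) refl ; 1F → refl ; 2F → refl }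
      ; 2F → λ { 0F → prove ρ (pABAᵗ 0F 2F) (pABAᵗ 2F 0F) refl
               ; 1F → prove ρ (pABAᵗ 1F 2F) (pABAᵗ 2F 1F) refl
               ; 2F → refl }
      }
      where
      ρ : Vec Carrier 15
      ρ = A ++ₘ y ++₆ Vec.[]

  maps-congruencePoint : ∀ g y → Maps g y (congruencePoint g y)
  maps-congruencePoint (A , _) (y , _) =
    1# , 1≉0 , λ i j → trans (congruence-symmetric A y i j) (sym (*-identityˡ _))

  maps⇒congruence : ∀ g y z → Maps g y z →
    ∃ λ t → proj₁ z ≋ λ i → t * congruence (proj₁ g) (proj₁ y) i
  maps⇒congruence g y z (t , _ , eq) = t , λ
    { 0F → eq 0F 0F
    ; 1F → eq 0F 1F
    ; 2F → eq 0F 2F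
    ; 3F → eq 1F 1F
    ; 4F → eq 1F 2F
    ; 5F → eq 2F 2F
    }

  -- The hyperplanes through the representative of o₈,₂.
  Apolar : Carrier → Vector Carrier 6 → Set ℓ
  Apolar δ a = a 0F ≈ 0# × a 3F ≈ δ * a 5F

  module _ (δ : Carrier) where

    representative : Point 1 → Point 5
    representative (v , v≉0) =
      (v 0F ∷ 0# ∷ 0# ∷ v 1F ∷ 0# ∷ - (δ * v 1F) ∷ []) ,
      λ eq → v≉0 λ { 0F → eq 0F ; 1F → eq 3F }

    representative-∈ : ∀ v → InRepresentative₈₂ δ (representative v)
    representative-∈ v = v , 1# , 1≉0 , λ
      { 0F → λ { 0F → 1*- ; 1F → 1*- ; 2F → 1*- }
      ; 1F → λ { 0F → 1*- ; 1F → 1*- ; 2F → 1*- }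
      ; 2F → λ { 0F → 1*- ; 1F → 1*- ; 2F → 1*- }
      }
      where
      1*- : ∀ {x} → x ≈ 1# * x
      1*- = sym (*-identityˡ _)

    ∈-representative : ∀ y → InRepresentative₈₂ δ y →
      ∃ λ v → proj₁ (representative v) ∼ proj₁ y
    ∈-representative y (v , s , s≉0 , eq) = v , Setoid.sym (PG 5) {y} {representative v} (s , s≉0 , λ
      { 0F → eq 0F 0F
      ; 1F → eq 0F 1F
      ; 2F → eq 0F 2F
      ; 3F → eq 1F 1F
      ; 4F → eq 1F 2F
      ; 5F → eq 2F 2F
      })

    opaque
      pairing-representative : ∀ a v → let x = proj₁ v 0F ; y = proj₁ v 1F in
        pairing a (proj₁ (representative v)) ≈ x * a 0F + y * (a 3F - δ * a 5F)
      pairing-representative a v = prove (δ Vec.∷ proj₁ v 0F Vec.∷ proj₁ v 1F Vec.∷ a ++₆ Vec.[])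
        (P.pairing (vec₆ 3) (var 1F ∷ :0 ∷ :0 ∷ var 2F ∷ :0 ∷ :- (var 0F :* var 2F) ∷ []))
        (var 1F :* vec₆ 3 0F :+ var 2F :* (vec₆ 3 3F :- var 0F :* vec₆ 3 5F)) refl

    apolar⇒pairing≈0 : ∀ {a} → Apolar δ a → ∀ v → pairing a (proj₁ (representative v)) ≈ 0#
    apolar⇒pairing≈0 {a} (a₀₀≈0 , a₁₁≈δa₂₂) v = trans (pairing-representative a v)
      (trans (+-cong (trans (*-congˡ a₀₀≈0) (zeroʳ _))
        (trans (*-congˡ (trans (+-congʳ a₁₁≈δa₂₂) (-‿inverseʳ _))) (zeroʳ _))) (+-identityʳ 0#))

    -- The points with parameters (1, 0) and (0, 1) span the representative and give one equation
    -- each.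
    pairing≈0⇒apolar : ∀ {a} → (∀ v → pairing a (proj₁ (representative v)) ≈ 0#) → Apolar δ a
    pairing≈0⇒apolar {a} eq = a₀₀≈0 , x-y≈0⇒x≈y a₁₁-δa₂₂≈0
      where
      opaque
        a₀₀≈0 : a 0F ≈ 0#
        a₀₀≈0 = trans (prove (δ Vec.∷ a ++₆ Vec.[]) (vec₆ 1 0F)
          (:1 :* vec₆ 1 0F :+ :0 :* (vec₆ 1 3F :- var 0F :* vec₆ 1 5F)) refl)
          (trans (sym (pairing-representative a v)) (eq v))
          where
          v : Point 1
          v = (1# ∷ 0# ∷ []) , λ v≋0 → 1≉0 (v≋0 0F)

        a₁₁-δa₂₂≈0 : a 3F - δ * a 5F ≈ 0#
        a₁₁-δa₂₂≈0 = trans (prove (δ Vec.∷ a ++₆ Vec.[]) (vec₆ 1 3F :- var 0F :* vec₆ 1 5F)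
          (:0 :* vec₆ 1 0F :+ :1 :* (vec₆ 1 3F :- var 0F :* vec₆ 1 5F)) refl)
          (trans (sym (pairing-representative a v)) (eq v))
          where
          v : Point 1
          v = (0# ∷ 1# ∷ []) , λ v≋0 → 1≉0 (v≋0 1F)

    module _ (L : Line 5) (L∈o₈₂ : InOrbit₈₂ δ L) (a : Hyperplane) where

      private
        g : GL₃
        g = proj₁ L∈o₈₂

        A : Matrix
        A = proj₁ g

      -- Images under A of the points of the representative lie on L, and adjointness moves A from
      -- the point to the form.
      ⊆⇒apolar : L ⊆ a → Apolar δ (act A (proj₁ a))
      ⊆⇒apolar L⊆a = pairing≈0⇒apolar {act A (proj₁ a)} λ v → trans
        (sym (pairing-act A (proj₁ a) (proj₁ (representative v))))
        (L⊆a (congruencePoint g (representative v))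
          (Equivalence.from (proj₂ L∈o₈₂ (congruencePoint g (representative v)))
          (representative v , representative-∈ v , maps-congruencePoint g (representative v))))

      -- Conversely, each point of L is, up to the scalars t and s, the image of a point of the
      -- representative.
      apolar⇒⊆ : Apolar δ (act A (proj₁ a)) → L ⊆ a
      apolar⇒⊆ apolar z z∈L =
        let y , y∈ , y↦z = Equivalence.to (proj₂ L∈o₈₂ z) z∈L
            v , s , _ , y≋ = ∈-representative y y∈
            t , z≋ = maps⇒congruence g y z y↦z
            a′ = act A (proj₁ a)
            y′ = proj₁ (representative v)
        in begin
          pairing (proj₁ a) (proj₁ z)
            ≈⟨ pairing-congʳ (proj₁ a) z≋ ⟩
          pairing (proj₁ a) (λ i → t * congruence A (proj₁ y) i)
            ≈⟨ pairing-scaleʳ t (proj₁ a) (congruence A (proj₁ y)) ⟩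
          t * pairing (proj₁ a) (congruence A (proj₁ y))
            ≈⟨ *-congˡ (pairing-act A (proj₁ a) (proj₁ y)) ⟩
          t * pairing a′ (proj₁ y)
            ≈⟨ *-congˡ (pairing-congʳ a′ y≋) ⟩
          t * pairing a′ (λ i → s * y′ i)
            ≈⟨ *-congˡ (pairing-scaleʳ s a′ y′) ⟩
          t * (s * pairing a′ y′)
            ≈⟨ *-congˡ (*-congˡ (apolar⇒pairing≈0 {a′} apolar v)) ⟩
          t * (s * 0#)
            ≈⟨ trans (*-congˡ (zeroʳ s)) (zeroʳ t) ⟩
          0# ∎
        where open SetoidReasoning setoid

-- Normal forms of the hyperplanes through a line of o₈,₂

module NormalForms {q : ℕ} (F : FiniteField c ℓ q) (δ : FiniteField.Carrier F) where

  open import Data.Vec.Functional using (Vector; []; _∷_)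
  open FiniteField F
  open FieldProperties F
  open ProjectiveGeometry F
  open VectorEquality setoid using (_≋_; ≋-refl)
  open Action F
  open GroupAction F

  Pencil : Setoid _ _
  Pencil = setoid ×ₛ (setoid ×ₛ setoid)

  -- Indexes the forms apolar to the representative: they are
  -- X(bY + dZ) + c(δY² + Z²) + eYZ with (b, d, c, e) ≠ 0 up to scalars.
  NormalForm : Setoid _ _
  NormalForm = ≡.setoid (Fin 1) ⊎ₛ (setoid ⊎ₛ ((setoid ×ₛ setoid) ⊎ₛ Pencil))

  -- YZ
  nf₁ : Fin 1 → Hyperplane
  nf₁ _ = (0# ∷ 0# ∷ 0# ∷ 0# ∷ 1# ∷ 0# ∷ []) , λ eq → 1≉0 (eq 4F)

  -- δY² + eYZ + Z²
  nf₂ : Carrier → Hyperplane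
  nf₂ e = (0# ∷ 0# ∷ 0# ∷ δ ∷ e ∷ 1# ∷ []) , λ eq → 1≉0 (eq 5F)

  -- Z(X + eY) + c(δY² + Z²)
  nf₃ : Carrier × Carrier → Hyperplane
  nf₃ (e , c) = (0# ∷ 0# ∷ 1# ∷ δ * c ∷ e ∷ c ∷ []) , λ eq → 1≉0 (eq 2F)

  -- (Y + dZ)(X + s(δdY + Z)) + t(δY² + δdYZ + Z²); in these coordinates the
  -- singular forms are those with t = 0.
  nf₄ : Carrier × Carrier × Carrier → Hyperplane
  nf₄ (d , s , t) =
    (0# ∷ 1# ∷ d ∷ δ * (s * d + t) ∷ s * (δ * (d * d) + 1#) + t * (δ * d) ∷ s * d + t ∷ []) ,
    λ eq → 1≉0 (eq 1F)

  nf : Setoid.Carrier NormalForm → Hyperplane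
  nf = [ nf₁ , [ nf₂ , [ nf₃ , nf₄ ] ] ]

  nf-apolar : ∀ n → Apolar δ (proj₁ (nf n))
  nf-apolar (inj₁ _)               = refl , sym (zeroʳ δ)
  nf-apolar (inj₂ (inj₁ _))        = refl , sym (*-identityʳ δ)
  nf-apolar (inj₂ (inj₂ (inj₁ _))) = refl , refl
  nf-apolar (inj₂ (inj₂ (inj₂ _))) = refl , refl

  module _ {n : ℕ} {u v : Vector Carrier n} (u∼v : u ∼ v) where

    -- The scalar can be read off at coordinate j, where it must be 1.
    ∼⇒≋ : ∀ j → u j ≈ 1# → v j ≈ 1# → u ≋ v
    ∼⇒≋ j uj≈1 vj≈1 i = let s , _ , v≋su = u∼v
                            1≈s = trans (sym vj≈1) (trans (v≋su j)
                                    (trans (*-congˡ uj≈1) (*-identityʳ s)))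
                        in trans (sym (*-identityˡ (u i))) (trans (*-congʳ 1≈s) (sym (v≋su i)))

    0≁1 : ∀ j → u j ≈ 0# → ¬ v j ≈ 1#
    0≁1 j uj≈0 vj≈1 = let s , _ , v≋su = u∼v in
      1≉0 (trans (sym vj≈1) (trans (v≋su j) (trans (*-congˡ uj≈0) (zeroʳ s))))

    1≁0 : ∀ j → u j ≈ 1# → ¬ v j ≈ 0#
    1≁0 j uj≈1 vj≈0 = let s , s≉0 , v≋su = u∼v in
      s≉0 (trans (sym (*-identityʳ s)) (trans (*-congˡ (sym uj≈1)) (trans (sym (v≋su j)) vj≈0)))

  opaque
    -- With c = sd + t and e the coefficient of YZ, the parameters are recovered as s = e - δdc and
    -- t = c - sd.
    nf₄-injective : ∀ {d s t d′ s′ t′} → d ≈ d′ →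
      s * (δ * (d * d) + 1#) + t * (δ * d) ≈ s′ * (δ * (d′ * d′) + 1#) + t′ * (δ * d′) →
      s * d + t ≈ s′ * d′ + t′ → s ≈ s′ × t ≈ t′
    nf₄-injective {d} {s} {t} {d′} {s′} {t′} d≈d′ e≈e′ c≈c′ = s≈s′ , by-combination
      (+-cong c≈c′ (+-cong (*-congˡ {s′} (sym d≈d′)) (*-congˡ {d} (sym s≈s′))))
      (solve 6 (λ d s t d′ s′ t′ →
        t :+ (s′ :* d′ :+ t′ :+ (s′ :* d :+ d :* s)) :=
        t′ :+ (s :* d :+ t :+ (s′ :* d′ :+ d :* s′))) refl d s t d′ s′ t′)
      where
      s≈s′ : s ≈ s′
      s≈s′ = by-combination
        (+-cong e≈e′ (+-cong (*-congˡ {δ * d} (sym c≈c′)) (*-congˡ {δ * (s′ * d′ + t′)} (sym d≈d′))))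
        (solve 7 (λ δ d s t d′ s′ t′ →
          let c = s :* d :+ t
              c′ = s′ :* d′ :+ t′
              e = s :* (δ :* (d :* d) :+ :1) :+ t :* (δ :* d)
              e′ = s′ :* (δ :* (d′ :* d′) :+ :1) :+ t′ :* (δ :* d′) in
          s :+ (e′ :+ (δ :* d :* c :+ δ :* c′ :* d)) :=
          s′ :+ (e :+ (δ :* d :* c′ :+ δ :* c′ :* d′))) refl δ d s t d′ s′ t′)

  -- Vanishing of the coefficients of XY, XZ and Z², tested in this order, tells the families apart;
  -- inside a family a coefficient 1 fixes the scalar.
  nf-injective : ∀ {m n} → proj₁ (nf m) ∼ proj₁ (nf n) → Setoid._≈_ NormalForm m n
  nf-injective {inj₁ 0F} {inj₁ 0F} _ = inj₁ ≡.refl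
  nf-injective {inj₁ _} {inj₂ (inj₁ _)} m∼n = ⊥-elim (0≁1 m∼n 5F refl refl)
  nf-injective {inj₁ _} {inj₂ (inj₂ (inj₁ _))} m∼n = ⊥-elim (0≁1 m∼n 2F refl refl)
  nf-injective {inj₁ _} {inj₂ (inj₂ (inj₂ _))} m∼n = ⊥-elim (0≁1 m∼n 1F refl refl)
  nf-injective {inj₂ (inj₁ _)} {inj₁ _} m∼n = ⊥-elim (1≁0 m∼n 5F refl refl)
  nf-injective {inj₂ (inj₁ _)} {inj₂ (inj₁ _)} m∼n = inj₂ (inj₁ (∼⇒≋ m∼n 5F refl refl 4F))
  nf-injective {inj₂ (inj₁ _)} {inj₂ (inj₂ (inj₁ _))} m∼n = ⊥-elim (0≁1 m∼n 2F refl refl)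
  nf-injective {inj₂ (inj₁ _)} {inj₂ (inj₂ (inj₂ _))} m∼n = ⊥-elim (0≁1 m∼n 1F refl refl)
  nf-injective {inj₂ (inj₂ (inj₁ _))} {inj₁ _} m∼n = ⊥-elim (1≁0 m∼n 2F refl refl)
  nf-injective {inj₂ (inj₂ (inj₁ _))} {inj₂ (inj₁ _)} m∼n = ⊥-elim (1≁0 m∼n 2F refl refl)
  nf-injective {inj₂ (inj₂ (inj₁ _))} {inj₂ (inj₂ (inj₁ _))} m∼n =
    let m≋n = ∼⇒≋ m∼n 2F refl refl in inj₂ (inj₂ (inj₁ (m≋n 4F , m≋n 5F)))
  nf-injective {inj₂ (inj₂ (inj₁ _))} {inj₂ (inj₂ (inj₂ _))} m∼n = ⊥-elim (0≁1 m∼n 1F refl refl)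
  nf-injective {inj₂ (inj₂ (inj₂ _))} {inj₁ _} m∼n = ⊥-elim (1≁0 m∼n 1F refl refl)
  nf-injective {inj₂ (inj₂ (inj₂ _))} {inj₂ (inj₁ _)} m∼n = ⊥-elim (1≁0 m∼n 1F refl refl)
  nf-injective {inj₂ (inj₂ (inj₂ _))} {inj₂ (inj₂ (inj₁ _))} m∼n = ⊥-elim (1≁0 m∼n 1F refl refl)
  nf-injective {inj₂ (inj₂ (inj₂ _))} {inj₂ (inj₂ (inj₂ _))} m∼n =
    let m≋n = ∼⇒≋ m∼n 1F refl refl
    in inj₂ (inj₂ (inj₂ (m≋n 2F , nf₄-injective (m≋n 2F) (m≋n 4F) (m≋n 5F))))

  nf-cong : ∀ {m n} → Setoid._≈_ NormalForm m n → proj₁ (nf m) ∼ proj₁ (nf n)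
  nf-cong {m} {n} m≈n = 1# , 1≉0 , λ i → trans (sym (pointwise m≈n i)) (sym (*-identityˡ _))
    where
    pointwise : ∀ {m n} → Setoid._≈_ NormalForm m n → proj₁ (nf m) ≋ proj₁ (nf n)
    pointwise (inj₁ _) = ≋-refl
    pointwise (inj₂ (inj₁ e≈)) = λ
      { 0F → refl ; 1F → refl ; 2F → refl ; 3F → refl ; 4F → e≈ ; 5F → refl }
    pointwise (inj₂ (inj₂ (inj₁ (e≈ , c≈)))) = λ
      { 0F → refl ; 1F → refl ; 2F → refl ; 3F → *-congˡ c≈ ; 4F → e≈ ; 5F → c≈ }
    pointwise (inj₂ (inj₂ (inj₂ (d≈ , s≈ , t≈)))) = λ
      { 0F → refl ; 1F → refl ; 2F → d≈ ; 3F → *-congˡ (+-cong (*-cong s≈ d≈) t≈)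
      ; 4F → +-cong (*-cong s≈ (+-congʳ (*-congˡ (*-cong d≈ d≈)))) (*-cong t≈ (*-congˡ d≈))
      ; 5F → +-cong (*-cong s≈ d≈) t≈ }

  opaque
    nf₄-recover-c : ∀ d s c → c ≈ s * d + (c - s * d)
    nf₄-recover-c = solve 3 (λ d s c → c := s :* d :+ (c :- s :* d)) refl

    nf₄-recover-e : ∀ d c e → let s = e - δ * d * c in
      e ≈ s * (δ * (d * d) + 1#) + (c - s * d) * (δ * d)
    nf₄-recover-e = solve 4 (λ δ d c e →
      let s = e :- δ :* d :* c in
      e := s :* (δ :* (d :* d) :+ :1) :+ (c :- s :* d) :* (δ :* d)) refl δ

  module _ {a : Vector Carrier 6} (apolar : Apolar δ a) where

    private
      a₀₀≈0 : a 0F ≈ 0#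
      a₀₀≈0 = proj₁ apolar

      a₁₁≈δa₂₂ : a 3F ≈ δ * a 5F
      a₁₁≈δa₂₂ = proj₂ apolar

      rescale : ∀ {x i} y → x * i ≈ 1# → y ≈ x * (i * y)
      rescale {x} {i} y xi≈1 =
        trans (sym (*-identityˡ y)) (trans (*-congʳ (sym xi≈1)) (*-assoc x i y))

      vanishing : ∀ {x} y → x ≈ 0# → x ≈ y * 0#
      vanishing y x≈0 = trans x≈0 (sym (zeroʳ y))

      unit : ∀ x → x ≈ x * 1#
      unit x = sym (*-identityʳ x)

      a₁₁≈ : ∀ {x y} → a 5F ≈ x * y → a 3F ≈ x * (δ * y)
      a₁₁≈ {x} {y} eq = trans a₁₁≈δa₂₂ (trans (*-congˡ eq)
        (trans (sym (*-assoc δ x y)) (trans (*-congʳ (*-comm δ x)) (*-assoc x δ y))))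

    opaque
      nf-surjective₄ : a 1F ≉ 0# → ∃ λ n → proj₁ (nf₄ n) ∼ a
      nf-surjective₄ b≉0 = (d , s , t) , a 1F , b≉0 , λ
        { 0F → vanishing _ a₀₀≈0
        ; 1F → unit _
        ; 2F → rescale _ bi≈1
        ; 3F → a₁₁≈ a₂₂≈
        ; 4F → trans (rescale (a 4F) bi≈1) (*-congˡ (nf₄-recover-e d (i * a 5F) (i * a 4F)))
        ; 5F → a₂₂≈
        }
        where
        i : Carrier
        i = proj₁ (inverse (a 1F) b≉0)
        d s t : Carrier
        -- After division by b, the inverse formulas s = e - δdc and t = c - sd apply with c = a₂₂/b
        -- and e = a₁₂/b.
        d = i * a 2F
        s = i * a 4F - δ * d * (i * a 5F)
        t = i * a 5F - s * d
        bi≈1 : a 1F * i ≈ 1#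
        bi≈1 = proj₂ (inverse (a 1F) b≉0)
        a₂₂≈ : a 5F ≈ a 1F * (s * d + t)
        a₂₂≈ = trans (rescale (a 5F) bi≈1) (*-congˡ (nf₄-recover-c d s (i * a 5F)))

      nf-surjective₃ : a 1F ≈ 0# → a 2F ≉ 0# → ∃ λ n → proj₁ (nf₃ n) ∼ a
      nf-surjective₃ b≈0 d≉0 = (i * a 4F , i * a 5F) , a 2F , d≉0 , λ
        { 0F → vanishing _ a₀₀≈0
        ; 1F → vanishing _ b≈0
        ; 2F → unit _
        ; 3F → a₁₁≈ (rescale _ di≈1)
        ; 4F → rescale _ di≈1
        ; 5F → rescale _ di≈1
        }
        where
        i : Carrier
        i = proj₁ (inverse (a 2F) d≉0)
        di≈1 : a 2F * i ≈ 1#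
        di≈1 = proj₂ (inverse (a 2F) d≉0)

      nf-surjective₂ : a 1F ≈ 0# → a 2F ≈ 0# → a 5F ≉ 0# → ∃ λ n → proj₁ (nf₂ n) ∼ a
      nf-surjective₂ b≈0 d≈0 c≉0 = i * a 4F , a 5F , c≉0 , λ
        { 0F → vanishing _ a₀₀≈0
        ; 1F → vanishing _ b≈0
        ; 2F → vanishing _ d≈0
        ; 3F → trans a₁₁≈δa₂₂ (*-comm δ _)
        ; 4F → rescale _ ci≈1
        ; 5F → unit _
        }
        where
        i : Carrier
        i = proj₁ (inverse (a 5F) c≉0)
        ci≈1 : a 5F * i ≈ 1#
        ci≈1 = proj₂ (inverse (a 5F) c≉0)

      nf-surjective₁ : a 1F ≈ 0# → a 2F ≈ 0# → a 5F ≈ 0# → ¬ a ≋ 0ᵥ → ∃ λ n → proj₁ (nf₁ n) ∼ a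
      nf-surjective₁ b≈0 d≈0 c≈0 a≉0 = 0F , a 4F , (λ e≈0 → a≉0 (λ
          { 0F → a₀₀≈0 ; 1F → b≈0 ; 2F → d≈0 ; 3F → a₁₁≈0 ; 4F → e≈0 ; 5F → c≈0 })) , λ
        { 0F → vanishing _ a₀₀≈0
        ; 1F → vanishing _ b≈0
        ; 2F → vanishing _ d≈0
        ; 3F → vanishing _ a₁₁≈0
        ; 4F → unit _
        ; 5F → vanishing _ c≈0
        }
        where
        a₁₁≈0 : a 3F ≈ 0#
        a₁₁≈0 = trans a₁₁≈δa₂₂ (trans (*-congˡ c≈0) (zeroʳ δ))

  nf-surjective : ∀ (a : Hyperplane) → Apolar δ (proj₁ a) → ∃ λ n → proj₁ (nf n) ∼ proj₁ a
  nf-surjective (a , a≉0) apolar with a 1F ≟ 0#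
  ... | no  b≉0 = let n , n∼a = nf-surjective₄ {a} apolar b≉0 in inj₂ (inj₂ (inj₂ n)) , n∼a
  ... | yes b≈0 with a 2F ≟ 0#
  ...   | no  d≉0 = let n , n∼a = nf-surjective₃ {a} apolar b≈0 d≉0 in inj₂ (inj₂ (inj₁ n)) , n∼a
  ...   | yes d≈0 with a 5F ≟ 0#
  ...     | no  c≉0 = let n , n∼a = nf-surjective₂ {a} apolar b≈0 d≈0 c≉0 in inj₂ (inj₁ n) , n∼a
  ...     | yes c≈0 = let n , n∼a = nf-surjective₁ {a} apolar b≈0 d≈0 c≈0 a≉0 in inj₁ n , n∼a

-- The four classes of hyperplanes

module Classes {q : ℕ} (F : FiniteField c ℓ q)
  {δ : FiniteField.Carrier F} (δ-nonSquare : FiniteField.NonSquare F δ) where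

  open import Data.Vec.Functional using (Vector)
  open FiniteField F
  open FieldProperties F
  open ProjectiveGeometry F
  open HyperplaneOrbits F δ-nonSquare
  open QuadraticExtension F δ-nonSquare
  open VectorEquality setoid using (_≋_; ≋-sym; ≋-trans)
  open Action F
  open GroupAction F
  open NormalForms F δ

  private
    module K = FiniteField F[√δ]
    module KP = FieldProperties F[√δ]
    module PK = ProjectiveGeometry F[√δ]
    module KA = Action F[√δ]

  -- What is needed to move a class between hyperplanes through L and their normal forms, which
  -- match only up to g and a scalar.
  record Invariant {h} (H : Hyperplane → Set h) : Set (c ⊔ ℓ ⊔ h) where
    field
      •-closed : ∀ g a → H a → H (g • a)
      ∼-closed : ∀ a b → proj₁ a ∼ proj₁ b → H a → H b

  scalar≉0 : ∀ (a : Hyperplane) {s} (u : Vector Carrier 6) → proj₁ a ≋ (λ i → s * u i) → s ≉ 0#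
  scalar≉0 (a , a≉0) u a≋su s≈0 = a≉0 λ i → trans (a≋su i) (trans (*-congʳ s≈0) (zeroˡ _))

  -- Apolarity of a multiple of l² says l₀² = 0 and l₁² = δl₂², and δ is a non-square, so l would
  -- vanish.
  ℋ₁-not-apolar : ∀ a → Apolar δ (proj₁ a) → ¬ ℋ₁ a
  ℋ₁-not-apolar a (a₀₀≈0 , a₁₁≈δa₂₂) (s , (l , l≉0) , a≋sll) = l≉0 λ
    { 0F → square-zero (nonzero-cancel s≉0 (trans (sym (a≋sll 0F)) a₀₀≈0))
    ; 1F → proj₁ l₁₂≈0
    ; 2F → proj₂ l₁₂≈0
    }
    where
    s≉0 : s ≉ 0#
    s≉0 = scalar≉0 a (l ⊙ l) a≋sll
    l₁₂≈0 : l 1F ≈ 0# × l 2F ≈ 0#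
    l₁₂≈0 = anisotropic δ-nonSquare (*-cancelˡ-nonzero s≉0 (trans (sym (a≋sll 3F))
      (trans a₁₁≈δa₂₂ (trans (*-congˡ (a≋sll 5F)) (trans (sym (*-assoc δ s _))
        (trans (*-congʳ (*-comm δ s)) (*-assoc s δ _)))))))

  ℋ₁-invariant : Invariant ℋ₁
  ℋ₁-invariant = record
    { •-closed = λ { g@(A , _) (a , _) (s , l , a≋) → s , l ◂ g ,
        ≋-trans (act-congʳ A a≋) (≋-trans (act-scale A s (proj₁ l ⊙ proj₁ l))
          (λ i → *-congˡ (act-⊙ A (proj₁ l) (proj₁ l) i))) }
    ; ∼-closed = λ { _ _ (t , _ , b≋ta) (s , l , a≋) → t * s , l ,
        λ i → trans (b≋ta i) (trans (*-congˡ (a≋ i)) (sym (*-assoc t s _))) }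
    }

  opaque
    scale-⊙ : ∀ t l m → (λ i → t * (l ⊙ m) i) ≋ (λ i → t * l i) ⊙ m
    scale-⊙ t l m = λ
      { 0F → prove ρ (x 0F) (y 0F) refl
      ; 1F → prove ρ (x 1F) (y 1F) refl
      ; 2F → prove ρ (x 2F) (y 2F) refl
      ; 3F → prove ρ (x 3F) (y 3F) refl
      ; 4F → prove ρ (x 4F) (y 4F) refl
      ; 5F → prove ρ (x 5F) (y 5F) refl
      }
      where
      ρ : Vec Carrier 7
      ρ = t Vec.∷ (l ++ᵥ m ++ᵥ Vec.[])
      x y : Vector (Polynomial 7) 6
      x i = var 0F :* (vec₃ 1 P.⊙ vec₃ 4) i
      y = (λ i → var 0F :* vec₃ 1 i) P.⊙ vec₃ 4

  ℋ₂ᵣ-invariant : Invariant ℋ₂ᵣ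
  ℋ₂ᵣ-invariant = record
    { •-closed = λ { g@(A , _) (a , _) (l , m , l≁m , a≋) →
        l ◂ g , m ◂ g , l≁m ∘ ◂-∼ g , ≋-trans (act-congʳ A a≋) (act-⊙ A (proj₁ l) (proj₁ m)) }
    -- `ℋ₂ᵣ` allows no outer scalar, so t is absorbed into the first factor.
    ; ∼-closed = λ { _ _ (t , t≉0 , b≋ta) ((l , l≉0) , m , l≁m , a≋) →
        ((λ i → t * l i) , λ tl≋0 → l≉0 (λ i → nonzero-cancel t≉0 (tl≋0 i))) , m ,
        (λ { (s , s≉0 , m≋stl) → l≁m
          (s * t , nonzero-product s≉0 t≉0 , λ i → trans (m≋stl i) (sym (*-assoc s t (l i)))) }) ,
        ≋-trans b≋ta (≋-trans (λ i → *-congˡ (a≋ i)) (scale-⊙ t l (proj₁ m))) }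
    }

  ℋ₃-invariant : Invariant ℋ₃
  ℋ₃-invariant = record
    -- `disc-act` is applied to the inverse B, which expresses the discriminant of a through that of
    -- its image and avoids showing that det A is nonzero.
    { •-closed = λ { g@(A , B , _) (a , _) disc≉0 disc≈0 → disc≉0
        (trans (disc-cong (≋-sym (act-inverse g a))) (trans (disc-act B (act A a))
          (trans (*-congˡ disc≈0) (zeroʳ _)))) }
    ; ∼-closed = λ { (a , _) _ (t , t≉0 , b≋ta) disc≉0 disc≈0 →
        nonzero-product (nonzero-product (nonzero-product t≉0 t≉0) t≉0) disc≉0
          (trans (sym (trans (disc-cong b≋ta) (disc-scale t a))) disc≈0) }
    }

  Independent : Vector Carrier 3 → Vector Carrier 3 → Set _
  Independent x y = ∀ p r → (λ i → p * x i + r * y i) ≋ 0ᵥ → p ≈ 0# × r ≈ 0#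

  normForm : Vector Carrier 3 → Vector Carrier 3 → Vector Carrier 6
  normForm x y i = (x ⊙ x) i - δ * (y ⊙ y) i

  -- The members of ℋ₂ᵢ written over F: the form is s(x + y√δ)(x − y√δ).
  Anisotropic : Hyperplane → Set _
  Anisotropic (a , _) = ∃ λ s → ∃₂ λ x y → Independent x y × a ≋ λ i → s * normForm x y i

  Anisotropic-invariant : Invariant Anisotropic
  Anisotropic-invariant = record
    { •-closed = λ { g@(A , _) (a , _) (s , x , y , xy-independent , a≋) → s , x ▷ A , y ▷ A ,
        (λ p r eq → xy-independent p r (▷≋0⇒≋0 g (≋-trans (▷-linear A p r x y) eq))) ,
        ≋-trans (act-congʳ A a≋) (≋-trans (act-combination A s δ (x ⊙ x) (y ⊙ y))
          (λ i → *-congˡ (+-cong (act-⊙ A x x i) (-‿cong (*-congˡ (act-⊙ A y y i)))))) }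
    ; ∼-closed = λ { _ _ (t , _ , b≋ta) (s , x , y , xy-independent , a≋) →
        t * s , x , y , xy-independent ,
        λ i → trans (b≋ta i) (trans (*-congˡ (a≋ i)) (sym (*-assoc t s _))) }
    }

  private
    module _ (s : Carrier) (x y : Vector Carrier 3) where

      l l̄ : Vector K.Carrier 3
      l i = x i , y i
      l̄ i = x i , - y i

      ρ : Vec Carrier 8
      ρ = δ Vec.∷ s Vec.∷ (x ++ᵥ y ++ᵥ Vec.[])

      -- Symbolic arithmetic of F(√δ), with δ as variable 0: an identity over F(√δ) becomes two
      -- polynomial identities over F.
      module PK′ = FormOperations {A = Polynomial 8 × Polynomial 8}
        (λ (a , b) (c , d) → a :+ c , b :+ d)
        (λ (a , b) (c , d) → a :* c :+ var 0F :* (b :* d) , a :* d :+ b :* c)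
        (λ (a , b) (c , d) → a :- c , b :- d)
        (:0 , :0)

      product : Vector (Polynomial 8 × Polynomial 8) 6
      product i = let u , v = ((λ i → vec₃ 2 i , vec₃ 5 i) PK′.⊙ (λ i → vec₃ 2 i , :- vec₃ 5 i)) i
                  in var 1F :* u :+ var 0F :* (:0 :* v) , var 1F :* v :+ :0 :* u

      norm : Vector (Polynomial 8) 6
      norm i = var 1F :* ((vec₃ 2 P.⊙ vec₃ 2) i :- var 0F :* (vec₃ 5 P.⊙ vec₃ 5) i)

      opaque
        conjugate-product : ∀ i → embed s K.* (l KA.⊙ l̄) i K.≈ embed (s * normForm x y i)
        conjugate-product = λ
          { 0F → prove ρ (u 0F) (norm 0F) refl , prove ρ (v 0F) :0 refl
          ; 1F → prove ρ (u 1F) (norm 1F) refl , prove ρ (v 1F) :0 refl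
          ; 2F → prove ρ (u 2F) (norm 2F) refl , prove ρ (v 2F) :0 refl
          ; 3F → prove ρ (u 3F) (norm 3F) refl , prove ρ (v 3F) :0 refl
          ; 4F → prove ρ (u 4F) (norm 4F) refl , prove ρ (v 4F) :0 refl
          ; 5F → prove ρ (u 5F) (norm 5F) refl , prove ρ (v 5F) :0 refl
          }
          where
          u v : Vector (Polynomial 8) 6
          u i = proj₁ (product i)
          v i = proj₂ (product i)

  -- If px + ry = 0 then (r + p√δ)l is fixed by conjugation, so l and its conjugate are
  -- proportional.
  opaque
    ℋ₂ᵢ⇒anisotropic : ∀ a → ℋ₂ᵢ a → Anisotropic a
    ℋ₂ᵢ⇒anisotropic (a , _) (s , (l , _) , (l̄ , _) , l̄≈ , l≁l̄ , a≈sll̄) =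
      s , x , y , independent , λ i → proj₁ (K.trans (a≈sll̄ i) (K.trans
        (K.*-congˡ {embed s} (KA.⊙-cong {l} {l} {l̄} {λ i → conjugate (l i)} (λ _ → K.refl) l̄≈ i))
        (conjugate-product s x y i)))
      where
      x y : Vector Carrier 3
      x i = proj₁ (l i)
      y i = proj₂ (l i)

      conjugates-proportional : ∀ p r → (λ i → p * x i + r * y i) ≋ 0ᵥ →
        ¬ ((r , p) K.≈ K.0#) → l PK.∼ l̄
      conjugates-proportional p r eq μ≉0 =
        -- The scalar is μ/μ̄, with ν the inverse of μ̄, because invariance of μl under conjugation
        -- reads μ̄l̄ = μl.
        μ K.* ν , KP.nonzero-product μ≉0 ν≉0 , λ i → KP.*-cancelˡ-nonzero μ̄≉0 (begin
          μ̄ K.* l̄ i                 ≈⟨ K.*-congˡ {μ̄} (l̄≈ i) ⟩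
          μ̄ K.* conjugate (l i)     ≈⟨ rational i ⟩
          μ K.* l i                 ≈⟨ K.*-identityˡ (μ K.* l i) ⟨
          K.1# K.* (μ K.* l i)      ≈⟨ K.*-congʳ {μ K.* l i} μ̄ν≈1 ⟨
          μ̄ K.* ν K.* (μ K.* l i)   ≈⟨ rearrange μ̄ ν μ (l i) ⟩
          μ̄ K.* (μ K.* ν K.* l i)   ∎)
        where
        open SetoidReasoning K.setoid

        μ μ̄ : K.Carrier
        μ = r , p
        μ̄ = r , - p

        μ̄≉0 : μ̄ K.≉ K.0#
        μ̄≉0 (r≈0 , -p≈0) = μ≉0 (r≈0 , by-combination (sym -p≈0)
          (solve 1 (λ p → p :+ :- p := :0 :+ :0) refl p))

        ν : K.Carrier
        ν = proj₁ (K.inverse μ̄ μ̄≉0)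

        μ̄ν≈1 : μ̄ K.* ν K.≈ K.1#
        μ̄ν≈1 = proj₂ (K.inverse μ̄ μ̄≉0)

        ν≉0 : ν K.≉ K.0#
        ν≉0 ν≈0 = K.1≉0 (K.trans (K.sym μ̄ν≈1) (K.trans (K.*-congˡ {μ̄} ν≈0) (K.zeroʳ μ̄)))

        rational : ∀ i → μ̄ K.* conjugate (l i) K.≈ μ K.* l i
        rational i =
          solve 5 (λ δ p r x y →
            r :* x :+ δ :* (:- p :* :- y) := r :* x :+ δ :* (p :* y)) refl δ p r (x i) (y i) ,
          by-combination (*-congˡ { - (1# + 1#)} (eq i))
            (solve 4 (λ p r x y → r :* :- y :+ :- p :* x :+ :- (:1 :+ :1) :* :0 :=
              r :* y :+ p :* x :+ :- (:1 :+ :1) :* (p :* x :+ r :* y)) refl p r (x i) (y i))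

        rearrange : ∀ a b c d → a K.* b K.* (c K.* d) K.≈ a K.* (c K.* b K.* d)
        rearrange = KP.solve 4 (λ a b c d →
          a KP.:* b KP.:* (c KP.:* d) KP.:= a KP.:* (c KP.:* b KP.:* d)) K.refl

      independent : Independent x y
      independent p r eq with p ≟ 0# | r ≟ 0#
      ... | yes p≈0 | yes r≈0 = p≈0 , r≈0
      ... | yes p≈0 | no  r≉0 = ⊥-elim (l≁l̄ (conjugates-proportional p r eq λ (r≈0 , _) → r≉0 r≈0))
      ... | no  p≉0 | _       = ⊥-elim (l≁l̄ (conjugates-proportional p r eq λ (_ , p≈0) → p≉0 p≈0))

    -- If l̄ = (g + h√δ)l, comparing components gives (g - 1)x + δhy = 0 and hx + (g + 1)y = 0.
    -- Independence then forces g = 1 and g = -1, against 2 ≠ 0.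
    anisotropic⇒ℋ₂ᵢ : ∀ a → Anisotropic a → ℋ₂ᵢ a
    anisotropic⇒ℋ₂ᵢ (a , _) (s , x , y , independent , a≋) =
      s , ((λ i → x i , y i) , λ l≋0 → x≉0 (λ i → proj₁ (l≋0 i))) ,
      ((λ i → x i , - y i) , λ l̄≋0 → x≉0 (λ i → proj₁ (l̄≋0 i))) ,
      (λ _ → K.refl) , l≁l̄ , λ i → K.trans (a≋ i , refl) (K.sym (conjugate-product s x y i))
      where
      x≉0 : ¬ x ≋ 0ᵥ
      x≉0 x≋0 = 1≉0 (proj₁ (independent 1# 0# λ i →
        trans (+-cong (trans (*-identityˡ _) (x≋0 i)) (zeroˡ _)) (+-identityʳ 0#)))

      l≁l̄ : ¬ (λ i → x i , y i) PK.∼ (λ i → x i , - y i)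
      l≁l̄ ((g , h) , _ , eq) = 1+1≉0 δ-nonSquare (by-combination (+-cong (sym g-1≈0) g+1≈0)
        (solve 1 (λ g → :1 :+ :1 :+ (g :- :1 :+ :0) := :0 :+ (:0 :+ (g :+ :1))) refl g))
        where
        g-1≈0 : g - 1# ≈ 0#
        g-1≈0 = proj₁ (independent (g - 1#) (δ * h) λ i → by-combination (sym (proj₁ (eq i)))
          (solve 5 (λ δ g h x y →
            (g :- :1) :* x :+ δ :* h :* y :+ x := :0 :+ (g :* x :+ δ :* (h :* y)))
            refl δ g h (x i) (y i)))

        g+1≈0 : g + 1# ≈ 0#
        g+1≈0 = proj₂ (independent h (g + 1#) λ i → by-combination (sym (proj₂ (eq i)))
          (solve 4 (λ g h x y → h :* x :+ (g :+ :1) :* y :+ :- y := :0 :+ (g :* y :+ h :* x))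
            refl g h (x i) (y i)))

  -- The description over F spares an extension of the action to forms over F(√δ).
  ℋ₂ᵢ-invariant : Invariant ℋ₂ᵢ
  ℋ₂ᵢ-invariant = record
    { •-closed = λ g a a∈ → anisotropic⇒ℋ₂ᵢ (g • a)
        (•-closed g a (ℋ₂ᵢ⇒anisotropic a a∈))
    ; ∼-closed = λ a b a∼b a∈ → anisotropic⇒ℋ₂ᵢ b
        (∼-closed a b a∼b (ℋ₂ᵢ⇒anisotropic a a∈))
    }
    where open Invariant Anisotropic-invariant

-- Classes of the normal forms and the resulting counts

module Classification {q : ℕ} (F : FiniteField c ℓ q)
  {δ : FiniteField.Carrier F} (δ-nonSquare : FiniteField.NonSquare F δ) where

  open import Data.Vec.Functional using (Vector; []; _∷_)
  open FiniteField F
  open FieldProperties F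
  open ProjectiveGeometry F
  open HyperplaneOrbits F δ-nonSquare
  open VectorEquality setoid using (_≋_)
  open Action F
  open GroupAction F
  open NormalForms F δ
  open Classes F δ-nonSquare

  private
    IsSplit : Carrier → Set _
    IsSplit = Split δ-nonSquare

  ℋ₂ᵣ⇒disc≈0 : ∀ a → ℋ₂ᵣ a → discriminant (proj₁ a) ≈ 0#
  ℋ₂ᵣ⇒disc≈0 _ (l , m , _ , a≋lm) = trans (disc-cong a≋lm) (disc-⊙ (proj₁ l) (proj₁ m))

  opaque
    disc-nf₁ : ∀ i → discriminant (proj₁ (nf₁ i)) ≈ 0#
    disc-nf₁ _ = prove Vec.[] (P.disc (:0 ∷ :0 ∷ :0 ∷ :0 ∷ :1 ∷ :0 ∷ [])) :0 refl

    disc-nf₂ : ∀ e → discriminant (proj₁ (nf₂ e)) ≈ 0#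
    disc-nf₂ e = prove (δ Vec.∷ e Vec.∷ Vec.[])
      (P.disc (:0 ∷ :0 ∷ :0 ∷ var 0F ∷ var 1F ∷ :1 ∷ [])) :0 refl

    disc-nf₃ : ∀ n → discriminant (proj₁ (nf₃ n)) ≈ - (δ * proj₂ n)
    disc-nf₃ (e , c) = prove (δ Vec.∷ e Vec.∷ c Vec.∷ Vec.[])
      (P.disc (:0 ∷ :0 ∷ :1 ∷ var 0F :* var 2F ∷ var 1F ∷ var 2F ∷ []))
      (:- (var 0F :* var 2F)) refl

    disc-nf₄ : ∀ n → discriminant (proj₁ (nf₄ n)) ≈ - proj₂ (proj₂ n)
    disc-nf₄ (d , s , t) = solve 4 (λ δ d s t →
      P.disc (:0 ∷ :1 ∷ d ∷ δ :* (s :* d :+ t) ∷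
              s :* (δ :* (d :* d) :+ :1) :+ t :* (δ :* d) ∷ s :* d :+ t ∷ [])
        := :- t) refl δ d s t

    -≈0⇒≈0 : ∀ {x} → - x ≈ 0# → x ≈ 0#
    -≈0⇒≈0 {x} -x≈0 = by-combination (sym -x≈0) (solve 1 (λ x → x :+ :- x := :0 :+ :0) refl x)

    ≈0⇒-≈0 : ∀ {x} → x ≈ 0# → - x ≈ 0#
    ≈0⇒-≈0 {x} x≈0 = by-combination (sym x≈0) (solve 1 (λ x → :- x :+ x := :0 :+ :0) refl x)

  disc-nf₃≈0⇒c≈0 : ∀ n → discriminant (proj₁ (nf₃ n)) ≈ 0# → proj₂ n ≈ 0#
  disc-nf₃≈0⇒c≈0 n eq = nonzero-cancel (δ≉0 δ-nonSquare) (-≈0⇒≈0 (trans (sym (disc-nf₃ n)) eq))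

  disc-nf₄≈0⇒t≈0 : ∀ n → discriminant (proj₁ (nf₄ n)) ≈ 0# → proj₂ (proj₂ n) ≈ 0#
  disc-nf₄≈0⇒t≈0 n eq = -≈0⇒≈0 (trans (sym (disc-nf₄ n)) eq)

  opaque
    nf₁∈ℋ₂ᵣ : ∀ i → ℋ₂ᵣ (nf₁ i)
    nf₁∈ℋ₂ᵣ _ = (l , λ l≋0 → 1≉0 (l≋0 1F)) , (m , λ m≋0 → 1≉0 (m≋0 2F)) ,
      (λ l∼m → 0≁1 l∼m 2F refl refl) , λ
      { 0F → solve 0 (:0 := :0 :* :0) refl
      ; 1F → solve 0 (:0 := :0 :* :0 :+ :1 :* :0) refl
      ; 2F → solve 0 (:0 := :0 :* :1 :+ :0 :* :0) refl
      ; 3F → solve 0 (:0 := :1 :* :0) refl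
      ; 4F → solve 0 (:1 := :1 :* :1 :+ :0 :* :0) refl
      ; 5F → solve 0 (:0 := :0 :* :1) refl
      }
      where
      l m : Vector Carrier 3
      l = 0# ∷ 1# ∷ 0# ∷ []
      m = 0# ∷ 0# ∷ 1# ∷ []

    split⇒nf₂∈ℋ₂ᵣ : ∀ e → IsSplit e → ℋ₂ᵣ (nf₂ e)
    split⇒nf₂∈ℋ₂ᵣ e (u , uu+δ≈eu) = (l , λ l≋0 → 1≉0 (l≋0 2F)) , (m , λ m≋0 → 1≉0 (m≋0 2F)) ,
      -- Both factors have Z-coefficient 1, so proportional factors would be equal: u = e - u, hence
      -- u² = δ.
      (λ l∼m → δ-nonSquare u (trans (*-congˡ (∼⇒≋ l∼m 2F refl refl 1F)) (sym δ≈lm))) , λ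
      { 0F → solve 0 (:0 := :0 :* :0) refl
      ; 1F → solve 2 (λ e u → :0 := :0 :* (e :- u) :+ u :* :0) refl e u
      ; 2F → solve 0 (:0 := :0 :* :1 :+ :1 :* :0) refl
      ; 3F → δ≈lm
      ; 4F → solve 2 (λ e u → e := u :* :1 :+ :1 :* (e :- u)) refl e u
      ; 5F → solve 0 (:1 := :1 :* :1) refl
      }
      where
      l m : Vector Carrier 3
      l = 0# ∷ u ∷ 1# ∷ []
      m = 0# ∷ e - u ∷ 1# ∷ []

      δ≈lm : δ ≈ u * (e - u)
      δ≈lm = by-combination uu+δ≈eu
        (solve 3 (λ δ e u → δ :+ e :* u := u :* (e :- u) :+ (u :* u :+ δ)) refl δ e u)

    -- Scaling the first factor to Z-coefficient 1 gives u = l₁/l₂, which is l₁m₂ because l₂m₂ = 1.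
    nf₂∈ℋ₂ᵣ⇒split : ∀ e → ℋ₂ᵣ (nf₂ e) → IsSplit e
    nf₂∈ℋ₂ᵣ⇒split e ((l , _) , (m , _) , _ , a≋lm) = l 1F * m 2F , by-combination
      (+-cong (a≋lm 3F) (+-cong (*-congˡ {l 1F * m 1F} (a≋lm 5F))
        (*-congˡ {l 1F * m 2F} (sym (a≋lm 4F)))))
      (solve 6 (λ δ e l₁ l₂ m₁ m₂ → let u = l₁ :* m₂ in
        u :* u :+ δ :+ (l₁ :* m₁ :+ (l₁ :* m₁ :* (l₂ :* m₂) :+ u :* e)) :=
        e :* u :+ (δ :+ (l₁ :* m₁ :* :1 :+ u :* (l₁ :* m₂ :+ l₂ :* m₁))))
        refl δ e (l 1F) (l 2F) (m 1F) (m 2F))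

    c≈0⇒nf₃∈ℋ₂ᵣ : ∀ n → proj₂ n ≈ 0# → ℋ₂ᵣ (nf₃ n)
    c≈0⇒nf₃∈ℋ₂ᵣ (e , c) c≈0 = (l , λ l≋0 → 1≉0 (l≋0 2F)) , (m , λ m≋0 → 1≉0 (m≋0 0F)) ,
      (λ l∼m → 0≁1 l∼m 0F refl refl) , λ
      { 0F → solve 0 (:0 := :0 :* :1) refl
      ; 1F → solve 1 (λ e → :0 := :0 :* e :+ :0 :* :1) refl e
      ; 2F → solve 0 (:1 := :0 :* :0 :+ :1 :* :1) refl
      ; 3F → trans (*-congˡ c≈0) (solve 2 (λ δ e → δ :* :0 := :0 :* e) refl δ e)
      ; 4F → solve 1 (λ e → e := :0 :* :0 :+ :1 :* e) refl e
      ; 5F → trans c≈0 (solve 0 (:0 := :1 :* :0) refl)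
      }
      where
      l m : Vector Carrier 3
      l = 0# ∷ 0# ∷ 1# ∷ []
      m = 1# ∷ e ∷ 0# ∷ []

    t≈0⇒nf₄∈ℋ₂ᵣ : ∀ n → proj₂ (proj₂ n) ≈ 0# → ℋ₂ᵣ (nf₄ n)
    t≈0⇒nf₄∈ℋ₂ᵣ (d , s , t) t≈0 = (l , λ l≋0 → 1≉0 (l≋0 1F)) , (m , λ m≋0 → 1≉0 (m≋0 0F)) ,
      (λ l∼m → 0≁1 l∼m 0F refl refl) , λ
      { 0F → solve 0 (:0 := :0 :* :1) refl
      ; 1F → solve 3 (λ δ d s → :1 := :0 :* (s :* (δ :* d)) :+ :1 :* :1) refl δ d s
      ; 2F → solve 2 (λ d s → d := :0 :* s :+ d :* :1) refl d s
      ; 3F → trans (*-congˡ (+-congˡ t≈0)) (solve 3 (λ δ d s →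
          δ :* (s :* d :+ :0) := :1 :* (s :* (δ :* d))) refl δ d s)
      ; 4F → trans (+-congˡ (*-congʳ t≈0)) (solve 3 (λ δ d s →
          s :* (δ :* (d :* d) :+ :1) :+ :0 :* (δ :* d) := :1 :* s :+ d :* (s :* (δ :* d))) refl δ d s)
      ; 5F → trans (+-congˡ t≈0) (solve 2 (λ d s → s :* d :+ :0 := d :* s) refl d s)
      }
      where
      l m : Vector Carrier 3
      l = 0# ∷ 1# ∷ d ∷ []
      m = 1# ∷ s * (δ * d) ∷ s ∷ []

  module _ (a : Hyperplane) {s : Carrier} {x y : Vector Carrier 3}
    (a≋ : proj₁ a ≋ λ i → s * normForm x y i) where

    private
      s≉0 : s ≉ 0#
      s≉0 = scalar≉0 a (normForm x y) a≋

    isotropic⇒≈0 : ∀ {p r} → s * (p * p - δ * (r * r)) ≈ 0# → p ≈ 0# × r ≈ 0#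
    isotropic⇒≈0 eq = anisotropic δ-nonSquare (x-y≈0⇒x≈y (nonzero-cancel s≉0 eq))

    opaque
      polar≈0 : ∀ {x₀ y₀ x₁ y₁} → x₀ ≈ 0# → y₀ ≈ 0# →
        s * (x₀ * x₁ + x₁ * x₀ - δ * (y₀ * y₁ + y₁ * y₀)) ≈ 0#
      polar≈0 {x₀} {y₀} {x₁} {y₁} x₀≈0 y₀≈0 = by-combination
        (+-cong (*-congˡ {s * (x₁ + x₁)} x₀≈0) (*-congˡ {s * - (δ * (y₁ + y₁))} y₀≈0))
        (solve 6 (λ δ s x₀ y₀ x₁ y₁ →
          s :* (x₀ :* x₁ :+ x₁ :* x₀ :- δ :* (y₀ :* y₁ :+ y₁ :* y₀)) :+
            (s :* (x₁ :+ x₁) :* :0 :+ s :* :- (δ :* (y₁ :+ y₁)) :* :0) :=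
          :0 :+ (s :* (x₁ :+ x₁) :* x₀ :+ s :* :- (δ :* (y₁ :+ y₁)) :* y₀)) refl δ s x₀ y₀ x₁ y₁)

    -- The conic contains (1, 0, 0). There x and y both vanish by anisotropy, so the point is
    -- singular and every coefficient involving X₀ is 0.
    a₀₀≈0⇒a₀ⱼ≈0 : proj₁ a 0F ≈ 0# → proj₁ a 1F ≈ 0# × proj₁ a 2F ≈ 0#
    a₀₀≈0⇒a₀ⱼ≈0 a₀₀≈0 =
      let x₀≈0 , y₀≈0 = isotropic⇒≈0 (trans (sym (a≋ 0F)) a₀₀≈0)
      in trans (a≋ 1F) (polar≈0 x₀≈0 y₀≈0) , trans (a≋ 2F) (polar≈0 x₀≈0 y₀≈0)

    a₂₂≈0⇒a₁₂≈0 : proj₁ a 5F ≈ 0# → proj₁ a 4F ≈ 0#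
    a₂₂≈0⇒a₁₂≈0 a₂₂≈0 =
      let x₂≈0 , y₂≈0 = isotropic⇒≈0 (trans (sym (a≋ 5F)) a₂₂≈0)
      in trans (a≋ 4F) (trans (*-congˡ (+-cong (+-comm _ _) (-‿cong (*-congˡ (+-comm _ _)))))
           (polar≈0 x₂≈0 y₂≈0))

  nf₁∉ℋ₂ᵢ : ∀ i → ¬ ℋ₂ᵢ (nf₁ i)
  nf₁∉ℋ₂ᵢ i a∈ = let s , x , y , _ , a≋ = ℋ₂ᵢ⇒anisotropic (nf₁ i) a∈ in
    1≉0 (a₂₂≈0⇒a₁₂≈0 (nf₁ i) {s} {x} {y} a≋ refl)

  nf₃∉ℋ₂ᵢ : ∀ n → ¬ ℋ₂ᵢ (nf₃ n)
  nf₃∉ℋ₂ᵢ n a∈ = let s , x , y , _ , a≋ = ℋ₂ᵢ⇒anisotropic (nf₃ n) a∈ in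
    1≉0 (proj₂ (a₀₀≈0⇒a₀ⱼ≈0 (nf₃ n) {s} {x} {y} a≋ refl))

  nf₄∉ℋ₂ᵢ : ∀ n → ¬ ℋ₂ᵢ (nf₄ n)
  nf₄∉ℋ₂ᵢ n a∈ = let s , x , y , _ , a≋ = ℋ₂ᵢ⇒anisotropic (nf₄ n) a∈ in
    1≉0 (proj₁ (a₀₀≈0⇒a₀ⱼ≈0 (nf₄ n) {s} {x} {y} a≋ refl))

  opaque
    -- A root u puts (0, 1, -u) on the conic besides (1, 0, 0). Then x and y vanish at two distinct
    -- points, so they are proportional.
    nf₂∈ℋ₂ᵢ⇒¬split : ∀ e → ℋ₂ᵢ (nf₂ e) → ¬ IsSplit e
    nf₂∈ℋ₂ᵢ⇒¬split e a∈ (u , uu+δ≈eu) =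
      let s , x , y , independent , a≋ = ℋ₂ᵢ⇒anisotropic (nf₂ e) a∈
          x₀≈0 , y₀≈0 = isotropic⇒≈0 (nf₂ e) {s} {x} {y} a≋ (sym (a≋ 0F))
          x₁-ux₂≈0 , y₁-uy₂≈0 = isotropic⇒≈0 (nf₂ e) {s} {x} {y} a≋ {x 1F - u * x 2F} {y 1F - u * y 2F}
            (by-combination
              (+-cong uu+δ≈eu (+-cong (sym (a≋ 3F))
                (+-cong (*-congˡ {u * u} (sym (a≋ 5F))) (*-congˡ {u} (a≋ 4F)))))
              (solve 8 (λ δ e u s x₁ x₂ y₁ y₂ →
                let N = λ p r → s :* (p :* p :- δ :* (r :* r))
                    B = s :* (x₁ :* x₂ :+ x₂ :* x₁ :- δ :* (y₁ :* y₂ :+ y₂ :* y₁)) in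
                N (x₁ :- u :* x₂) (y₁ :- u :* y₂) :+ (e :* u :+ (δ :+ (u :* u :* :1 :+ u :* B))) :=
                :0 :+ (u :* u :+ δ :+ (N x₁ y₁ :+ (u :* u :* N x₂ y₂ :+ u :* e))))
                refl δ e u s (x 1F) (x 2F) (y 1F) (y 2F)))
          -- y₂x - x₂y vanishes at both points and has Z-coefficient 0, hence is 0. So x₂ = y₂ = 0,
          -- contradicting a₂₂ = 1.
          y₂≈0 , -x₂≈0 = independent (y 2F) (- x 2F) λ
            { 0F → by-combination (+-cong (*-congˡ {y 2F} x₀≈0) (*-congˡ { - x 2F} y₀≈0))
                (solve 4 (λ x₀ y₀ x₂ y₂ → y₂ :* x₀ :+ :- x₂ :* y₀ :+ (y₂ :* :0 :+ :- x₂ :* :0) :=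
                  :0 :+ (y₂ :* x₀ :+ :- x₂ :* y₀)) refl (x 0F) (y 0F) (x 2F) (y 2F))
            ; 1F → by-combination (+-cong (*-congˡ {y 2F} x₁-ux₂≈0) (*-congˡ { - x 2F} y₁-uy₂≈0))
                (solve 5 (λ u x₁ y₁ x₂ y₂ → y₂ :* x₁ :+ :- x₂ :* y₁ :+ (y₂ :* :0 :+ :- x₂ :* :0) :=
                  :0 :+ (y₂ :* (x₁ :- u :* x₂) :+ :- x₂ :* (y₁ :- u :* y₂)))
                  refl u (x 1F) (y 1F) (x 2F) (y 2F))
            ; 2F → solve 2 (λ x₂ y₂ → y₂ :* x₂ :+ :- x₂ :* y₂ := :0) refl (x 2F) (y 2F)
            }
      in 1≉0 (trans (a≋ 5F) (trans (*-congˡ (+-cong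
           (trans (*-congʳ (-≈0⇒≈0 -x₂≈0)) (zeroˡ _))
           (-‿cong (trans (*-congˡ (trans (*-congʳ y₂≈0) (zeroˡ _))) (zeroʳ δ)))))
           (solve 1 (λ s → s :* (:0 :- :0) := :0) refl s)))

    -- δY² + eYZ + Z² = (Z + ½eY)² − δ(½wY)² where e² − 4δ = δw².
    ¬split⇒nf₂∈ℋ₂ᵢ : ∀ e → ¬ IsSplit e → ℋ₂ᵢ (nf₂ e)
    ¬split⇒nf₂∈ℋ₂ᵢ e ¬split = anisotropic⇒ℋ₂ᵢ (nf₂ e) (1# , x , y , independent , λ
      { 0F → solve 1 (λ δ → :0 := :1 :* (:0 :* :0 :- δ :* (:0 :* :0))) refl δ
      ; 1F → solve 4 (λ δ e h w → :0 := :1 :* (:0 :* (h :* e) :+ h :* e :* :0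
               :- δ :* (:0 :* (h :* w) :+ h :* w :* :0))) refl δ e h w
      ; 2F → solve 1 (λ δ → :0 := :1 :* (:0 :* :1 :+ :1 :* :0 :- δ :* (:0 :* :0 :+ :0 :* :0))) refl δ
      ; 3F → by-combination (+-cong (*-congˡ {h * h} (sym ee≈))
          (*-congˡ {δ * (1# + (1# + 1#) * h)} (sym 2h≈1)))
          (solve 4 (λ δ e h w →
            δ :+ (h :* h :* (e :* e) :+ δ :* (:1 :+ (:1 :+ :1) :* h) :* ((:1 :+ :1) :* h)) :=
            :1 :* (h :* e :* (h :* e) :- δ :* (h :* w :* (h :* w))) :+
              (h :* h :* ((:1 :+ :1) :* (:1 :+ :1) :* δ :+ δ :* (w :* w)) :+
                δ :* (:1 :+ (:1 :+ :1) :* h) :* :1)) refl δ e h w)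
      ; 4F → by-combination (*-congˡ {e} (sym 2h≈1))
          (solve 4 (λ δ e h w → e :+ e :* ((:1 :+ :1) :* h) :=
            :1 :* (h :* e :* :1 :+ :1 :* (h :* e) :- δ :* (h :* w :* :0 :+ :0 :* (h :* w))) :+ e :* :1)
            refl δ e h w)
      ; 5F → solve 1 (λ δ → :1 := :1 :* (:1 :* :1 :- δ :* (:0 :* :0))) refl δ
      })
      where
      2⁻¹ : ∃ λ h → (1# + 1#) * h ≈ 1#
      2⁻¹ = inverse (1# + 1#) (1+1≉0 δ-nonSquare)

      √ : ∃ λ w → w ≉ 0# × e * e ≈ (1# + 1#) * (1# + 1#) * δ + δ * (w * w)
      √ = discriminant-δ-square δ-nonSquare ¬split

      h w : Carrier
      h = proj₁ 2⁻¹
      w = proj₁ √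

      2h≈1 : (1# + 1#) * h ≈ 1#
      2h≈1 = proj₂ 2⁻¹

      ee≈ : e * e ≈ (1# + 1#) * (1# + 1#) * δ + δ * (w * w)
      ee≈ = proj₂ (proj₂ √)

      h≉0 : h ≉ 0#
      h≉0 h≈0 = 1≉0 (trans (sym 2h≈1) (trans (*-congˡ h≈0) (zeroʳ _)))

      x y : Vector Carrier 3
      x = 0# ∷ h * e ∷ 1# ∷ []
      y = 0# ∷ h * w ∷ 0# ∷ []

      independent : Independent x y
      independent p r eq = p≈0 , nonzero-cancel (nonzero-product h≉0 (proj₁ (proj₂ √)))
        (by-combination (+-cong (eq 1F) (*-congˡ {h * e} (sym p≈0)))
          (solve 5 (λ e h w p r → h :* w :* r :+ (:0 :+ h :* e :* p) :=
            :0 :+ (p :* (h :* e) :+ r :* (h :* w) :+ h :* e :* :0)) refl e h w p r))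
        where
        p≈0 : p ≈ 0#
        p≈0 = trans (solve 2 (λ p r → p := p :* :1 :+ r :* :0) refl p r) (eq 2F)

  module _ (L : Line 5) (L∈o₈₂ : InOrbit₈₂ δ L) where

    private
      g : GL₃
      g = proj₁ L∈o₈₂

    -- n ↦ g⁻¹ • `nf` n is a bijection up to scalars from the normal forms in H to the hyperplanes
    -- in H through L, so H can be counted family by family.
    size-Through : ∀ {h} {H : Hyperplane → Set h} → Invariant H → ∀ {n₁ n₂ n₃ n₄} →
      HasSize (≡.setoid (Fin 1) ↾ H ∘ nf₁) n₁ →
      HasSize (setoid ↾ H ∘ nf₂) n₂ →
      HasSize (setoid ×ₛ setoid ↾ H ∘ nf₃) n₃ →
      HasSize (Pencil ↾ H ∘ nf₄) n₄ →
      HasSize (Through L H) (n₁ ℕ.+ (n₂ ℕ.+ (n₃ ℕ.+ n₄)))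
    size-Through {H = H} H-invariant size₁ size₂ size₃ size₄ = size-resp
      (bijection⇒inverse (NormalForm ↾ H ∘ nf) (Through L H) to
        (λ {(m , _)} {(n , _)} m≈n → •-∼ g⁻¹ {nf m} {nf n} (nf-cong {m} {n} m≈n))
        (λ {(m , _)} {(n , _)} m∼n → nf-injective {m} {n}
          (g•-cancel (inverseᴳ g) {nf m} {nf n} m∼n))
        surjective)
      (size-↾-⊎ {P = H ∘ nf} size₁ (size-↾-⊎ {P = λ n → H (nf (inj₂ n))} size₂
        (size-↾-⊎ {P = λ n → H (nf (inj₂ (inj₂ n)))} size₃ size₄)))
      where
      open Invariant H-invariant

      g⁻¹ : GL₃
      g⁻¹ = inverseᴳ g

      ∼-trans : ∀ {a b c : Hyperplane} → proj₁ a ∼ proj₁ b → proj₁ b ∼ proj₁ c → proj₁ a ∼ proj₁ c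
      ∼-trans {a} {b} {c} = Setoid.trans (PG 5) {a} {b} {c}

      ∼-sym : ∀ {a b : Hyperplane} → proj₁ a ∼ proj₁ b → proj₁ b ∼ proj₁ a
      ∼-sym {a} {b} = Setoid.sym (PG 5) {a} {b}

      g•-cancel : ∀ g {a b} → proj₁ (g • a) ∼ proj₁ (g • b) → proj₁ a ∼ proj₁ b
      g•-cancel g {a} {b} ga∼gb = ∼-trans {a} {inverseᴳ g • g • a} {b}
        (∼-sym {inverseᴳ g • g • a} {a} (•-inverse g a))
        (∼-trans {inverseᴳ g • g • a} {inverseᴳ g • g • b} {b}
          (•-∼ (inverseᴳ g) {g • a} {g • b} ga∼gb) (•-inverse g b))

      to : ∃ (H ∘ nf) → ∃ λ a → H a × L ⊆ a
      to (n , n∈H) = g⁻¹ • nf n , •-closed g⁻¹ (nf n) n∈H ,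
        apolar⇒⊆ δ L L∈o₈₂ (g⁻¹ • nf n)
          (let a₀₀≈0 , a₁₁≈δa₂₂ = nf-apolar n
               eq = act-inverse g⁻¹ (proj₁ (nf n))
           in trans (eq 0F) a₀₀≈0 , trans (eq 3F) (trans a₁₁≈δa₂₂ (*-congˡ (sym (eq 5F)))))

      surjective : ∀ ((a , _) : ∃ λ a → H a × L ⊆ a) → ∃ λ n → proj₁ (proj₁ (to n)) ∼ proj₁ a
      surjective (a , a∈H , L⊆a) =
        let n , n∼ga = nf-surjective (g • a) (⊆⇒apolar δ L L∈o₈₂ a L⊆a)
        in (n , ∼-closed (g • a) (nf n) (∼-sym {nf n} {g • a} n∼ga) (•-closed g a a∈H)) ,
           ∼-trans {g⁻¹ • nf n} {g⁻¹ • g • a} {a} (•-∼ g⁻¹ {nf n} {g • a} n∼ga) (•-inverse g a)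

    module _ {k : ℕ} (F*↔2k : HasSize (setoid ↾ (_≉ 0#)) (k ℕ.+ k))
      (split↔k : HasSize (setoid ↾ IsSplit) k)
      (¬split↔1+k : HasSize (setoid ↾ ¬_ ∘ IsSplit) (suc k)) where

      size-ℋ₁ : HasSize (Through L ℋ₁) 0
      size-ℋ₁ = size-Through ℋ₁-invariant
        (size-↾-∅ λ i → ℋ₁-not-apolar (nf₁ i) (nf-apolar (inj₁ i)))
        (size-↾-∅ λ e → ℋ₁-not-apolar (nf₂ e) (nf-apolar (inj₂ (inj₁ e))))
        (size-↾-∅ λ n → ℋ₁-not-apolar (nf₃ n) (nf-apolar (inj₂ (inj₂ (inj₁ n)))))
        (size-↾-∅ λ n → ℋ₁-not-apolar (nf₄ n) (nf-apolar (inj₂ (inj₂ (inj₂ n)))))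

      size-ℋ₂ᵣ : HasSize (Through L ℋ₂ᵣ) (1 ℕ.+ (k ℕ.+ (q ℕ.* 1 ℕ.+ q ℕ.* (q ℕ.* 1))))
      size-ℋ₂ᵣ = size-Through ℋ₂ᵣ-invariant
        (size-↾-all nf₁∈ℋ₂ᵣ (Identity.inverse (≡.setoid (Fin 1))))
        (size-↾-⇔ split⇒nf₂∈ℋ₂ᵣ nf₂∈ℋ₂ᵣ⇒split split↔k)
        (size-↾-⇔ c≈0⇒nf₃∈ℋ₂ᵣ (λ n n∈ → disc-nf₃≈0⇒c≈0 n (ℋ₂ᵣ⇒disc≈0 (nf₃ n) n∈))
          (size-↾-× size size-≈0))
        (size-↾-⇔ t≈0⇒nf₄∈ℋ₂ᵣ (λ n n∈ → disc-nf₄≈0⇒t≈0 n (ℋ₂ᵣ⇒disc≈0 (nf₄ n) n∈))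
          (size-↾-× {P = λ (_ , t) → t ≈ 0#} size (size-↾-× size size-≈0)))

      size-ℋ₂ᵢ : HasSize (Through L ℋ₂ᵢ) (0 ℕ.+ (suc k ℕ.+ 0))
      size-ℋ₂ᵢ = size-Through ℋ₂ᵢ-invariant
        (size-↾-∅ nf₁∉ℋ₂ᵢ)
        (size-↾-⇔ ¬split⇒nf₂∈ℋ₂ᵢ nf₂∈ℋ₂ᵢ⇒¬split ¬split↔1+k)
        (size-↾-∅ nf₃∉ℋ₂ᵢ)
        (size-↾-∅ nf₄∉ℋ₂ᵢ)

      -- The q - 1 nonzero values of c and of t contribute q(q - 1) and q²(q - 1).
      size-ℋ₃ : HasSize (Through L ℋ₃) (q ℕ.* (k ℕ.+ k) ℕ.+ q ℕ.* (q ℕ.* (k ℕ.+ k)))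
      size-ℋ₃ = size-Through ℋ₃-invariant
        (size-↾-∅ λ i disc≉0 → disc≉0 (disc-nf₁ i))
        (size-↾-∅ λ e disc≉0 → disc≉0 (disc-nf₂ e))
        (size-↾-⇔ (λ n c≉0 disc≈0 → c≉0 (disc-nf₃≈0⇒c≈0 n disc≈0))
          (λ n disc≉0 c≈0 → disc≉0 (trans (disc-nf₃ n) (≈0⇒-≈0 (trans (*-congˡ c≈0) (zeroʳ δ)))))
          (size-↾-× size F*↔2k))
        (size-↾-⇔ (λ n t≉0 disc≈0 → t≉0 (disc-nf₄≈0⇒t≈0 n disc≈0))
          (λ n disc≉0 t≈0 → disc≉0 (trans (disc-nf₄ n) (≈0⇒-≈0 t≈0)))
          (size-↾-× {P = λ (_ , t) → t ≉ 0#} size (size-↾-× size F*↔2k)))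


-- From k = (q - 1)/2 to the closed formulas

open import Data.Nat.Base using (_+_; _*_; _∸_; _^_; _/_)
open import Data.Vec.Base using (_∷_; [])

module _ where

  open ≡.≡-Reasoning
  open ℕSolver.+-*-Solver

  -- 3q + 1 = 2(3k + 2), so the integer division is exact.
  ℋ₂ᵣ-count : ∀ k q → 1 + (k + k) ≡ q →
    1 + (k + (q * 1 + q * (q * 1))) ≡ q ^ 2 + (3 * q + 1) / 2
  ℋ₂ᵣ-count k q ≡.refl = begin
    1 + (k + (q * 1 + q * (q * 1)))
      ≡⟨ solve 1 (λ k → let q = con 1 :+ (k :+ k) in
           con 1 :+ (k :+ (q :* con 1 :+ q :* (q :* con 1))) :=
           q :^ 2 :+ (con 3 :* k :+ con 2)) ≡.refl k ⟩
    q ^ 2 + (3 * k + 2)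
      ≡⟨ ≡.cong (q ^ 2 +_) (m*n/n≡m (3 * k + 2) 2) ⟨
    q ^ 2 + (3 * k + 2) * 2 / 2
      ≡⟨ ≡.cong (λ n → q ^ 2 + n / 2) (solve 1 (λ k →
           (con 3 :* k :+ con 2) :* con 2 := con 3 :* (con 1 :+ (k :+ k)) :+ con 1) ≡.refl k) ⟩
    q ^ 2 + (3 * q + 1) / 2 ∎

  ℋ₂ᵢ-count : ∀ k q → 1 + (k + k) ≡ q → suc k + 0 ≡ (q + 1) / 2
  ℋ₂ᵢ-count k q ≡.refl = begin
    suc k + 0        ≡⟨ ℕ.+-identityʳ (suc k) ⟩
    suc k              ≡⟨ m*n/n≡m (suc k) 2 ⟨
    suc k * 2 / 2    ≡⟨ ≡.cong (_/ 2) (solve 1 (λ k →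
      (con 1 :+ k) :* con 2 := con 1 :+ (k :+ k) :+ con 1) ≡.refl k) ⟩
    (q + 1) / 2      ∎

  ℋ₃-count : ∀ k q → 1 + (k + k) ≡ q →
    q * (k + k) + q * (q * (k + k)) ≡ q ^ 3 ∸ q
  ℋ₃-count k q ≡.refl = begin
    n                  ≡⟨ ℕ.m+n∸n≡m n q ⟨
    -- The truncated subtraction is exact because n + q = q³.
    n + q ∸ q        ≡⟨ ≡.cong (_∸ q) (solve 1 (λ k → let q = con 1 :+ (k :+ k) in
      q :* (k :+ k) :+ q :* (q :* (k :+ k)) :+ q := q :^ 3) ≡.refl k) ⟩
    q ^ 3 ∸ q          ∎
    where
    n : ℕ
    n = q * (k + k) + q * (q * (k + k))

lemma4p5 : {c ℓ : Level} {q : ℕ} → IsOddPrimePower q → (F : FiniteField c ℓ q)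
    {δ : FiniteField.Carrier F} (δ-nonSquare : FiniteField.NonSquare F δ)
    (L : ProjectiveGeometry.Line F 5) → ProjectiveGeometry.InOrbit₈₂ F δ L →
    HyperplaneOrbits.HasOD₄ F δ-nonSquare L
    (0 ∷ q ^ 2 + (3 * q + 1) / 2 ∷ (q + 1) / 2 ∷ q ^ 3 ∸ q ∷ [])
lemma4p5 {q = q} _ F δ-nonSquare L L∈o₈₂ =
  let k , 1+2k≡q , F*↔2k , split↔k , ¬split↔1+k = FieldProperties.sizes F δ-nonSquare
  in size-ℋ₁ L L∈o₈₂ F*↔2k split↔k ¬split↔1+k ,
     ≡.subst (HasSize _) (ℋ₂ᵣ-count k q 1+2k≡q) (size-ℋ₂ᵣ L L∈o₈₂ F*↔2k split↔k ¬split↔1+k) ,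
     ≡.subst (HasSize _) (ℋ₂ᵢ-count k q 1+2k≡q) (size-ℋ₂ᵢ L L∈o₈₂ F*↔2k split↔k ¬split↔1+k) ,
     ≡.subst (HasSize _) (ℋ₃-count k q 1+2k≡q) (size-ℋ₃ L L∈o₈₂ F*↔2k split↔k ¬split↔1+k)
  where open Classification F δ-nonSquare
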